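{- Let $\ell\geq 1$ be an integer. If a graph $G$ has a clean binary ear tree $(T, \mathcal{P})$ such that $T$ is isomorphic (as a rooted tree) to $\Gamma_{3\ell-2}$, then $G$ contains $\Gamma_{\ell}^{+}$ or $\nabla_\ell$ as a minor.
   Context: All graphs are finite and simple. $\Gamma_m$ is the complete binary tree of height $m$ (rooted; every non-leaf vertex has two children; every root-to-leaf path has $m$ edges). $\Gamma_\ell^+$ is obtained from $\Gamma_\ell$ by adding one new vertex adjacent to all its leaves. $\nabla_1$ is a triangle with a designated root edge; $\nabla_{\ell+1}$ is obtained from two disjoint copies of $\nabla_\ell$ with root edges $e_1,e_2$ and a triangle with edges $e_1',e_2',e_3$ by identifying $e_i$ with $e_i'$ ($i=1,2$), with $e_3$ the new root edge. The length of a path is its number of edges. If $H$ is a subgraph of $G$, an $H$-ear is a path in $G$ with both ends in $V(H)$ and no internal vertex in $V(H)$. A binary tree is a rooted tree in which every vertex has at most two children; $T_x$ denotes the subtree of $T$ rooted at $x$ (consisting of $x$ and its descendants). A binary ear tree in $G$ is a pair $(T,\mathcal{P})$ where $T$ is a binary tree and $\mathcal{P}=\{P_x:x\in V(T)\}$ is a collection of paths in $G$, each of length at least $2$, such that for every non-root vertex $x$ of $T$ with parent $y$: (1) $P_x$ is a $P_y$-ear, and (2) no internal vertex of $P_x$ lies in $\bigcup_{z\in V(T)\setminus V(T_x)}V(P_z)$. It is clean if for every non-leaf vertex $y$ of $T$, some end of $P_y$ is not contained in any $P_x$ with $x$ a child of $y$. -}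

module Defs where

open import Data.Nat using (ℕ; zero; suc; _≤_; _<_; _*_; _∸_)
open import Data.Fin using (Fin)
open import Data.Bool using (Bool)
open import Data.List using (List; []; _∷_; _++_; _∷ʳ_; length)
open import Data.List.Membership.Propositional using (_∈_)
open import Data.List.Relation.Unary.Unique.Propositional using (Unique)
open import Data.List.Relation.Unary.Linked using (Linked)
open import Data.Maybe using (Maybe; just; nothing)
open import Data.Product using (Σ; ∃; ∃-syntax; _×_; _,_; proj₁)
open import Data.Sum using (_⊎_)
open import Data.Unit using (⊤)
open import Data.Empty using (⊥)
open import Relation.Nullary using (¬_)
open import Relation.Binary.PropositionalEquality using (_≡_; _≢_)

record FinGraph (n : ℕ) : Set₁ where
  field
    Adj    : Fin n → Fin n → Set
    sym    : ∀ {u v} → Adj u v → Adj v u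
    irrefl : ∀ {u} → ¬ Adj u u
open FinGraph public

-- A graph on an arbitrary vertex type (used for the fixed target graphs
-- Γ_ℓ^+ and ∇_ℓ, which are finite and simple by construction).
record Graph : Set₁ where
  field
    V : Set
    E : V → V → Set
open Graph public

data WalkIn {n : ℕ} (G : FinGraph n) (S : Fin n → Set) : Fin n → Fin n → Set where
  stop : ∀ {u} → S u → WalkIn G S u u
  step : ∀ {u w v} → S u → Adj G u w → WalkIn G S w v → WalkIn G S u v

-- H is a minor of G: a model with nonempty, pairwise disjoint (φ is a
-- partial function), connected branch sets, and an edge of G between the
-- branch sets of every pair of adjacent vertices of H.
_≼_ : ∀ {n} → Graph → FinGraph n → Set
_≼_ {n} H G =
  Σ (Fin n → Maybe (V H)) λ φ →
    (∀ h → ∃[ g ] φ g ≡ just h)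
  × (∀ h u v → φ u ≡ just h → φ v ≡ just h → WalkIn G (λ w → φ w ≡ just h) u v)
  × (∀ h h' → E H h h' → ∃[ u ] ∃[ v ] (φ u ≡ just h × φ v ≡ just h' × Adj G u v))

-- Paths (as vertex sequences); length = number of edges = #vertices - 1

IsPath : ∀ {n} → FinGraph n → List (Fin n) → Set
IsPath G p = Unique p × Linked (Adj G) p × 1 ≤ length p

End : ∀ {n} → Fin n → List (Fin n) → Set
End v p = (∃[ q ] p ≡ v ∷ q) ⊎ (∃[ q ] p ≡ q ∷ʳ v)

Internal : ∀ {n} → Fin n → List (Fin n) → Set
Internal v p = ∃[ xs ] ∃[ ys ] (p ≡ xs ++ v ∷ ys × xs ≢ [] × ys ≢ [])

IsEar : ∀ {n} → List (Fin n) → List (Fin n) → Set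
IsEar p q = (∀ v → End v p → v ∈ q) × (∀ v → Internal v p → ¬ v ∈ q)

-- The complete binary tree Γ_m: vertices are addresses a : List Bool with
-- length a ≤ m; root = [], children of a are b ∷ a, parent of b ∷ a is a.

-- x ⊑ z : z lies in the subtree T_x (z is x or a descendant of x)
_⊑_ : List Bool → List Bool → Set
x ⊑ z = ∃[ d ] z ≡ d ++ x

BinaryEarTreeΓ : ∀ {n} → ℕ → FinGraph n → (List Bool → List (Fin n)) → Set
BinaryEarTreeΓ m G P =
    (∀ a → length a ≤ m → IsPath G (P a) × 2 ≤ length (P a) ∸ 1)
  × (∀ b a → length (b ∷ a) ≤ m → IsEar (P (b ∷ a)) (P a))
  × (∀ b a → length (b ∷ a) ≤ m → ∀ z → length z ≤ m → ¬ ((b ∷ a) ⊑ z)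
       → ∀ v → Internal v (P (b ∷ a)) → ¬ v ∈ P z)

Clean : ∀ {n} → ℕ → (List Bool → List (Fin n)) → Set
Clean m P = ∀ y → length y < m → ∃[ v ] (End v (P y) × (∀ b → ¬ v ∈ P (b ∷ y)))

GammaPlus : ℕ → Graph
GammaPlus ℓ = record { V = Maybe (Σ (List Bool) λ a → length a ≤ ℓ) ; E = e }
  where
  e : Maybe (Σ (List Bool) λ a → length a ≤ ℓ) → Maybe (Σ (List Bool) λ a → length a ≤ ℓ) → Set
  e (just a) (just b) = (∃[ x ] proj₁ b ≡ x ∷ proj₁ a) ⊎ (∃[ x ] proj₁ a ≡ x ∷ proj₁ b)
  e (just a) nothing  = length (proj₁ a) ≡ ℓ
  e nothing (just b)  = length (proj₁ b) ≡ ℓ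
  e nothing nothing   = ⊥

-- ∇_{k+1}. Vertices: the two ends of the root edge (inj₁ of Fin 2) and
-- the non-root vertices (inj₂ of NR k).
-- ∇_1: triangle, root edge {r0,r1}, apex tt.
-- ∇_{k+2}: triangle r0 r1 c (c the new apex, root edge {r0,r1}); copy 1
-- of ∇_{k+1} glued with its root edge onto {r0,c}, copy 2 onto {r1,c}.

NR : ℕ → Set
NR zero    = ⊤
NR (suc k) = ⊤ ⊎ (NR k ⊎ NR k)

NV : ℕ → Set
NV k = Fin 2 ⊎ NR k

module NablaConstruction where
  open import Data.Sum using (inj₁; inj₂)
  open import Data.Fin using (zero; suc)
  open import Data.Unit using (tt)

  r0 r1 : ∀ {k} → NV k
  r0 = inj₁ zero
  r1 = inj₁ (suc zero)

  apex : ∀ {k} → NV (suc k)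
  apex = inj₂ (inj₁ tt)

  emb1 emb2 : ∀ {k} → NV k → NV (suc k)
  emb1 (inj₁ zero)       = r0
  emb1 (inj₁ (suc zero)) = apex
  emb1 (inj₂ x)          = inj₂ (inj₂ (inj₁ x))
  emb2 (inj₁ zero)       = r1
  emb2 (inj₁ (suc zero)) = apex
  emb2 (inj₂ x)          = inj₂ (inj₂ (inj₂ x))

  Tri : ∀ {A : Set} → A → A → A → A → A → Set
  Tri x y z u v = (u ≡ x × v ≡ y) ⊎ (u ≡ y × v ≡ x) ⊎ (u ≡ x × v ≡ z)
                ⊎ (u ≡ z × v ≡ x) ⊎ (u ≡ y × v ≡ z) ⊎ (u ≡ z × v ≡ y)

  NE : ∀ k → NV k → NV k → Set
  NE zero    u v = Tri r0 r1 (inj₂ tt) u v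
  NE (suc k) u v = Tri r0 r1 apex u v
                 ⊎ (∃[ x ] ∃[ y ] (NE k x y × emb1 x ≡ u × emb1 y ≡ v))
                 ⊎ (∃[ x ] ∃[ y ] (NE k x y × emb2 x ≡ u × emb2 y ≡ v))

-- Nabla k is ∇_{k+1}
Nabla : ℕ → Graph
Nabla k = record { V = NV k ; E = NablaConstruction.NE k }

{-# OPTIONS --safe #-}

-- Cut every ear P_y of the tree at edges so that the ends of the two child ears fall into
-- different pieces. Either three consecutive pieces α, β, γ do, the first child joining α to β
-- and the second β to γ: then ∇-models carried by the children glue to a larger one, with β
-- in the new apex (only the root edge is missing). Or two pieces α, β do, both children
-- joining α to β: then α (without the end s of P_y) becomes a new root of a binary tree and β
-- goes into the dominating vertex, provided s lies on no child ear; if instead the other end t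
-- is the clean one, α and β swap roles. So each vertex of T has one of three kinds, and a
-- model carried by one child always extends along P_y; a Ramsey-type induction with one
-- parameter per kind gives the height 3ℓ - 2. The missing root edge costs one level: ∇_{ℓ+1}
-- without its root edge contains ∇_ℓ.

module Submission where

open import Defs
open import Data.Nat using (ℕ; zero; suc; _+_; _*_; _∸_; _≤_; z≤n; s≤s; s≤s⁻¹; _≤?_)
open import Data.Nat.Properties using (≤-irrelevant; ≤-reflexive; ≤-trans; +-suc; +-comm; +-assoc; +-identityʳ; m≤n+m; m≤m+n; 1+n≰n; m≤n+m∸n; suc-injective)
open import Data.Bool using (Bool; true; false)
open import Data.List using (List; []; _∷_; _++_; _∷ʳ_; length; [_]; initLast; _∷ʳ′_)
open import Data.List.Properties using (∷-injective; ++-assoc; ++-cancelʳ; ∷ʳ-++; ∷ʳ-injectiveˡ; ∷ʳ-injectiveʳ; length-++)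
open import Data.List.Membership.Propositional using (_∈_)
open import Data.List.Membership.Propositional.Properties using (∈-++⁺ˡ; ∈-++⁺ʳ; ∈-++⁻; ∈-∃++)
open import Data.List.Relation.Unary.All using (lookup)
open import Data.List.Relation.Unary.AllPairs using (_∷_)
open import Data.List.Relation.Unary.Any using (here; there)
open import Data.List.Relation.Unary.Linked using (Linked; []; [-]; _∷_)
open import Data.List.Relation.Unary.Unique.Propositional using (Unique)
open import Data.Fin using (Fin; zero; suc; _≟_)
open import Data.Maybe using (Maybe; just; nothing; map)
open import Data.Maybe.Properties using (just-injective)
open import Data.Product using (∃-syntax; _×_; _,_; proj₁; proj₂)
open import Data.Sum using (_⊎_; inj₁; inj₂; swap)
open import Data.Unit using (tt)
open import Data.Empty using (⊥-elim)
open import Function using (_∘_; id)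
open import Relation.Nullary using (¬_; Dec; yes; no)
open import Relation.Nullary.Decidable using (_⊎-dec_; map′)
open import Relation.Binary.PropositionalEquality using (_≡_; _≢_; refl; cong; subst; trans) renaming (sym to ≡-sym)
open NablaConstruction using (r0; r1; apex; emb1; emb2; Tri; NE)

-- Cutting a list and placing two chords on it.

module _ {A : Set} where

  linked-++ : ∀ {R : A → A → Set} α {β} → Linked R (α ++ β) → Linked R α × Linked R β
  linked-++ [] l = [] , l
  linked-++ (x ∷ []) [-] = [-] , []
  linked-++ (x ∷ []) (r ∷ l) = [-] , l
  linked-++ (x ∷ y ∷ α) (r ∷ l) with linked-++ (y ∷ α) l
  ... | la , lb = r ∷ la , lb

  linked-junction : ∀ {R : A → A → Set} α {β u v} → Linked R (α ++ β) → u ∈ α → v ∈ β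
    → ∃[ x ] ∃[ y ] (x ∈ α × y ∈ β × R x y)
  linked-junction (x ∷ []) {_ ∷ _} (r ∷ l) _ _ = _ , _ , here refl , here refl , r
  linked-junction (x ∷ y ∷ α) (r ∷ l) _ v∈ with linked-junction (y ∷ α) l (here refl) v∈
  ... | a , b , a∈ , b∈ , ab = a , b , there a∈ , b∈ , ab

  unique-disjoint : ∀ α {β} {w : A} → Unique (α ++ β) → w ∈ α → ¬ w ∈ β
  unique-disjoint (x ∷ α) (x∉ ∷ u) (here refl) w∈β = lookup x∉ (∈-++⁺ʳ α w∈β) refl
  unique-disjoint (x ∷ α) (x∉ ∷ u) (there w∈α) w∈β = unique-disjoint α u w∈α w∈β

  separate : ∀ {p} {a b : A} → a ∈ p → b ∈ p → a ≢ b
    → ∃[ α ] ∃[ β ] (p ≡ α ++ β × ((a ∈ α × b ∈ β) ⊎ (b ∈ α × a ∈ β)))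
  separate (here refl) (here refl) a≢b = ⊥-elim (a≢b refl)
  separate {x ∷ p} (here refl) (there b∈) _ = [ x ] , p , refl , inj₁ (here refl , b∈)
  separate {x ∷ p} (there a∈) (here refl) _ = [ x ] , p , refl , inj₂ (here refl , a∈)
  separate {x ∷ p} (there a∈) (there b∈) a≢b with separate a∈ b∈ a≢b
  ... | α , β , refl , inj₁ (a∈α , b∈β) = x ∷ α , β , refl , inj₁ (there a∈α , b∈β)
  ... | α , β , refl , inj₂ (b∈α , a∈β) = x ∷ α , β , refl , inj₂ (there b∈α , a∈β)

  ∷ʳ≢[] : ∀ xs {x : A} → xs ∷ʳ x ≢ []
  ∷ʳ≢[] [] ()
  ∷ʳ≢[] (_ ∷ _) ()

  ends-and-inner : ∀ (p : List A) → 2 ≤ length p ∸ 1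
    → ∃[ s ] ∃[ x ] ∃[ q ] ∃[ t ] (p ≡ s ∷ x ∷ q ∷ʳ t)
  ends-and-inner (s ∷ x ∷ []) (s≤s ())
  ends-and-inner (s ∷ x ∷ r@(_ ∷ _)) _ = let (q , t , r≡) = snoc r (λ ()) in
    s , x , q , t , cong (λ l → s ∷ x ∷ l) r≡
    where
    snoc : ∀ r → r ≢ [] → ∃[ q ] ∃[ t ] (r ≡ q ∷ʳ t)
    snoc r r≢ with initLast r
    ... | [] = ⊥-elim (r≢ refl)
    ... | q ∷ʳ′ t = q , t , refl

  record Split (p : List A) (E F : A → A → Set₁) : Set₁ where
    field
      α β γ   : List A
      a b c d : A
      p≡      : p ≡ α ++ (β ++ γ)
      Eab     : E a b
      Fcd     : F c d
      a∈α     : a ∈ α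
      b∈β     : b ∈ β
      c∈β     : c ∈ β
      d∈γ     : d ∈ γ

  record Overlap (p : List A) (E F : A → A → Set₁) : Set₁ where
    field
      α β     : List A
      a b c d : A
      p≡      : p ≡ α ++ β
      Eab     : E a b
      Fcd     : F c d
      a∈α     : a ∈ α
      b∈β     : b ∈ β
      c∈α     : c ∈ α
      d∈β     : d ∈ β

  -- `E` is required in both directions because the order in which the two ends occur along `p` is
  -- not known in advance; `orient` picks the direction that agrees with it.
  record Chord (p : List A) (E : A → A → Set₁) : Set₁ where
    constructor chord
    field
      {a b} : A
      Eab   : E a b
      Eba   : E b a
      a∈p   : a ∈ p
      b∈p   : b ∈ p
      a≢b   : a ≢ b

  orient : ∀ {p E} → Chord p E
    → ∃[ α ] ∃[ β ] ∃[ a ] ∃[ b ] (p ≡ α ++ β × E a b × a ∈ α × b ∈ β)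
  orient (chord ab ba a∈p b∈p a≢b) with separate a∈p b∈p a≢b
  ... | α , β , p≡ , inj₁ (a∈ , b∈) = α , β , _ , _ , p≡ , ab , a∈ , b∈
  ... | α , β , p≡ , inj₂ (b∈ , a∈) = α , β , _ , _ , p≡ , ba , b∈ , a∈

  -- Cut `p` between the ends of the first chord. If this also separates the ends of the second
  -- chord, the two overlap; otherwise both ends of the second lie on one side, and that side is cut
  -- again between them. Cuts fall between consecutive entries, so chords sharing an end need no
  -- separate treatment.
  arrange : ∀ {p E F} → Chord p E → Chord p F → Split p E F ⊎ Split p F E ⊎ Overlap p E F
  arrange {p} {E} {F} e (chord {c} {d} cd dc c∈p d∈p c≢d) with orient e
  ... | α , β , a , b , refl , ab , a∈α , b∈β = go (∈-++⁻ α c∈p) (∈-++⁻ α d∈p)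
    where
    go : c ∈ α ⊎ c ∈ β → d ∈ α ⊎ d ∈ β → Split p E F ⊎ Split p F E ⊎ Overlap p E F
    go (inj₁ c∈) (inj₂ d∈) = inj₂ (inj₂ (record
      { p≡ = refl ; Eab = ab ; Fcd = cd ; a∈α = a∈α ; b∈β = b∈β ; c∈α = c∈ ; d∈β = d∈ }))
    go (inj₂ c∈) (inj₁ d∈) = inj₂ (inj₂ (record
      { p≡ = refl ; Eab = ab ; Fcd = dc ; a∈α = a∈α ; b∈β = b∈β ; c∈α = d∈ ; d∈β = c∈ }))
    -- Now `α` is refined to `δ ++ ε`. If `a` is in `δ`, the new cut alone separates both chords; if
    -- `a` is in `ε`, the pieces `δ`, `ε`, `β` show the second chord followed by the first.
    go (inj₁ c∈) (inj₁ d∈) with orient {E = F} (chord cd dc c∈ d∈ c≢d)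
    ... | δ , ε , c′ , d′ , refl , cd′ , c∈δ , d∈ε with ∈-++⁻ δ a∈α
    ... | inj₁ a∈δ = inj₂ (inj₂ (record
      { p≡ = ++-assoc δ ε β ; Eab = ab ; Fcd = cd′
      ; a∈α = a∈δ ; b∈β = ∈-++⁺ʳ ε b∈β ; c∈α = c∈δ ; d∈β = ∈-++⁺ˡ d∈ε }))
    ... | inj₂ a∈ε = inj₂ (inj₁ (record
      { p≡ = ++-assoc δ ε β ; Eab = cd′ ; Fcd = ab
      ; a∈α = c∈δ ; b∈β = d∈ε ; c∈β = a∈ε ; d∈γ = b∈β }))
    go (inj₂ c∈) (inj₂ d∈) with orient {E = F} (chord cd dc c∈ d∈ c≢d)
    ... | δ , ε , c′ , d′ , refl , cd′ , c∈δ , d∈ε with ∈-++⁻ δ b∈β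
    ... | inj₁ b∈δ = inj₁ (record
      { p≡ = refl ; Eab = ab ; Fcd = cd′
      ; a∈α = a∈α ; b∈β = b∈δ ; c∈β = c∈δ ; d∈γ = d∈ε })
    ... | inj₂ b∈ε = inj₂ (inj₂ (record
      { p≡ = ≡-sym (++-assoc α δ ε) ; Eab = ab ; Fcd = cd′
      ; a∈α = ∈-++⁺ˡ a∈α ; b∈β = b∈ε ; c∈α = ∈-++⁺ʳ α c∈δ ; d∈β = d∈ε }))

-- Labels of the target graphs: the two copies inside ∇, and tree addresses.

emb1-injective : ∀ {k} {x y : NV k} → emb1 x ≡ emb1 y → x ≡ y
emb1-injective {x = inj₁ zero}       {inj₁ zero}       _    = refl
emb1-injective {x = inj₁ (suc zero)} {inj₁ (suc zero)} _    = refl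
emb1-injective {x = inj₂ _}          {inj₂ _}          refl = refl
emb1-injective {x = inj₁ zero}       {inj₁ (suc zero)} ()
emb1-injective {x = inj₁ (suc zero)} {inj₁ zero}       ()
emb1-injective {x = inj₁ zero}       {inj₂ _}          ()
emb1-injective {x = inj₁ (suc zero)} {inj₂ _}          ()
emb1-injective {x = inj₂ _}          {inj₁ zero}       ()
emb1-injective {x = inj₂ _}          {inj₁ (suc zero)} ()

emb2-injective : ∀ {k} {x y : NV k} → emb2 x ≡ emb2 y → x ≡ y
emb2-injective {x = inj₁ zero}       {inj₁ zero}       _    = refl
emb2-injective {x = inj₁ (suc zero)} {inj₁ (suc zero)} _    = refl
emb2-injective {x = inj₂ _}          {inj₂ _}          refl = refl
emb2-injective {x = inj₁ zero}       {inj₁ (suc zero)} ()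
emb2-injective {x = inj₁ (suc zero)} {inj₁ zero}       ()
emb2-injective {x = inj₁ zero}       {inj₂ _}          ()
emb2-injective {x = inj₁ (suc zero)} {inj₂ _}          ()
emb2-injective {x = inj₂ _}          {inj₁ zero}       ()
emb2-injective {x = inj₂ _}          {inj₁ (suc zero)} ()

emb1-image? : ∀ {k} (l : NV (suc k)) → Dec (∃[ x ] emb1 x ≡ l)
emb1-image? (inj₁ zero) = yes (r0 , refl)
emb1-image? (inj₁ (suc zero)) = no λ { (inj₁ zero , ()) ; (inj₁ (suc zero) , ()) ; (inj₂ _ , ()) }
emb1-image? (inj₂ (inj₁ tt)) = yes (r1 , refl)
emb1-image? (inj₂ (inj₂ (inj₁ x))) = yes (inj₂ x , refl)
emb1-image? (inj₂ (inj₂ (inj₂ x))) =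
  no λ { (inj₁ zero , ()) ; (inj₁ (suc zero) , ()) ; (inj₂ _ , ()) }

emb1-avoids-r1 : ∀ {k} (x : NV k) → emb1 x ≢ r1
emb1-avoids-r1 (inj₁ zero) ()
emb1-avoids-r1 (inj₁ (suc zero)) ()
emb1-avoids-r1 (inj₂ _) ()

emb2-avoids-r0 : ∀ {k} (x : NV k) → emb2 x ≢ r0
emb2-avoids-r0 (inj₁ zero) ()
emb2-avoids-r0 (inj₁ (suc zero)) ()
emb2-avoids-r0 (inj₂ _) ()

emb-meet : ∀ {k} (x y : NV k) → emb1 x ≡ emb2 y → emb2 y ≡ apex
emb-meet _ (inj₁ (suc zero)) _ = refl
emb-meet (inj₁ zero) (inj₁ zero) ()
emb-meet (inj₁ (suc zero)) (inj₁ zero) ()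
emb-meet (inj₂ _) (inj₁ zero) ()
emb-meet (inj₁ zero) (inj₂ _) ()
emb-meet (inj₁ (suc zero)) (inj₂ _) ()
emb-meet (inj₂ _) (inj₂ _) ()

-- Addresses grow at the front, so passing from the subtree at the child c of a vertex to the
-- tree at that vertex appends c at the back.
graft : Bool → Maybe (List Bool) → Maybe (List Bool)
graft c nothing  = nothing
graft c (just a) = just (a ∷ʳ c)

graft-injective : ∀ {c x y} → graft c x ≡ graft c y → x ≡ y
graft-injective {x = nothing} {nothing} _  = refl
graft-injective {x = just a}  {just b}  eq =
  cong just (∷ʳ-injectiveˡ a b (just-injective eq))

graft-avoids-root : ∀ {c} x → graft c x ≢ just []
graft-avoids-root (just []) ()
graft-avoids-root (just (_ ∷ _)) ()

graft-meet : ∀ {c c′} → c ≢ c′ → ∀ x y → graft c x ≡ graft c′ y → graft c′ y ≡ nothing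
graft-meet c≢ _ nothing _ = refl
graft-meet c≢ (just a) (just b) eq = ⊥-elim (c≢ (∷ʳ-injectiveʳ a b (just-injective eq)))

length-∷ʳ : ∀ (a : List Bool) c → length (a ∷ʳ c) ≡ suc (length a)
length-∷ʳ a c = trans (length-++ a) (+-comm (length a) 1)

⊎-exchange : ∀ {A B C : Set} → A ⊎ B ⊎ C → B ⊎ A ⊎ C
⊎-exchange (inj₁ a)        = inj₂ (inj₁ a)
⊎-exchange (inj₂ (inj₁ b)) = inj₁ b
⊎-exchange (inj₂ (inj₂ c)) = inj₂ (inj₂ c)

+-exchangeʳ : ∀ i j k → i + j + k ≡ i + k + j
+-exchangeʳ i j k = trans (+-assoc i j k)
  (trans (cong (i +_) (+-comm j k)) (≡-sym (+-assoc i k j)))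

+-suc₂₃ : ∀ i j k → i + suc j + suc k ≡ 2 + (i + j + k)
+-suc₂₃ i j k = trans (+-suc (i + suc j) k) (cong (λ l → suc (l + k)) (+-suc i j))

-- Walks, connected sets and contacts between sets.

module Models {n : ℕ} (G : FinGraph n) where

  VSet : Set₁
  VSet = Fin n → Set

  Connected : VSet → Set
  Connected A = ∀ {u v} → A u → A v → WalkIn G A u v

  Touching : VSet → VSet → Set
  Touching A B = ∃[ u ] ∃[ v ] (A u × B v × Adj G u v)

  -- The contact that lets two branch sets with the same label merge. Mostly they share a vertex;
  -- adjacency occurs when a piece of a path is merged into the root of a tree model, as in
  -- `tree-extend`.
  Near : VSet → VSet → Set
  Near A B = ∃[ u ] ∃[ v ] (A u × B v × (u ≡ v ⊎ Adj G u v))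

  touching-sym : ∀ {A B} → Touching A B → Touching B A
  touching-sym (u , v , a , b , uv) = v , u , b , a , sym G uv

  touching-mono : ∀ {A A′ B B′ : VSet} → (∀ {w} → A w → A′ w) → (∀ {w} → B w → B′ w)
    → Touching A B → Touching A′ B′
  touching-mono f g (u , v , a , b , uv) = u , v , f a , g b , uv

  walk-start : ∀ {A u v} → WalkIn G A u v → A u
  walk-start (stop a) = a
  walk-start (step a _ _) = a

  walk-trans : ∀ {A u v w} → WalkIn G A u v → WalkIn G A v w → WalkIn G A u w
  walk-trans (stop _) q = q
  walk-trans (step a e p) q = step a e (walk-trans p q)

  walk-reverse : ∀ {A u v} → WalkIn G A u v → WalkIn G A v u
  walk-reverse (stop a) = stop a
  walk-reverse (step a e p) =
    walk-trans (walk-reverse p) (step (walk-start p) (sym G e) (stop a))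

  walk-mono : ∀ {A B : VSet} {u v} → (∀ {w} → A w → B w) → WalkIn G A u v → WalkIn G B u v
  walk-mono f (stop a) = stop (f a)
  walk-mono f (step a e p) = step (f a) e (walk-mono f p)

  linked-connected : ∀ {α} → Linked (Adj G) α → Connected (_∈ α)
  linked-connected {x ∷ α} l u∈ v∈ = walk-trans (walk-reverse (from-head l u∈)) (from-head l v∈)
    where
    from-head : ∀ {x α v} → Linked (Adj G) (x ∷ α) → v ∈ x ∷ α → WalkIn G (_∈ x ∷ α) x v
    from-head _ (here refl) = stop (here refl)
    from-head (e ∷ l) (there v∈) = step (here refl) e (walk-mono there (from-head l v∈))

  -- Partial labellings with connected branch sets.

  Labelling : Set → Set₁
  Labelling L = Fin n → L → Set

  module _ {L : Set} where

    Branch : Labelling L → L → VSet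
    Branch R h w = R w h

    _∪_ : Labelling L → Labelling L → Labelling L
    (Q ∪ R) w h = Q w h ⊎ R w h

    seg : List (Fin n) → L → Labelling L
    seg α h w h′ = w ∈ α × h′ ≡ h

    -- A labelling is a relation, so that gluing is plain disjunction. The price is the field
    -- `functional`, and `labelled?` allows the partial function demanded by `_≼_` to be computed at
    -- the end.
    record Branching (R : Labelling L) : Set where
      field
        functional : ∀ {w h h′} → R w h → R w h′ → h ≡ h′
        connected  : ∀ h → Connected (Branch R h)
        labelled?  : ∀ w → Dec (∃[ h ] R w h)
    open Branching public

    ∪-branching : ∀ {Q R} → Branching Q → Branching R
      → (∀ {w h h′} → Q w h → R w h′ → h ≡ h′)
      → (∀ {u v h} → Q u h → R v h → Near (Branch Q h) (Branch R h))
      → Branching (Q ∪ R)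
    ∪-branching {Q} {R} bq br compat near = record
      { functional = λ { (inj₁ q) (inj₁ q′) → functional bq q q′
                       ; (inj₁ q) (inj₂ r)  → compat q r
                       ; (inj₂ r) (inj₁ q)  → ≡-sym (compat q r)
                       ; (inj₂ r) (inj₂ r′) → functional br r r′ }
      ; connected  = λ { h (inj₁ q) (inj₁ q′) → walk-mono inj₁ (connected bq h q q′)
                       ; h (inj₁ q) (inj₂ r)  → across h q r
                       ; h (inj₂ r) (inj₁ q)  → walk-reverse (across h q r)
                       ; h (inj₂ r) (inj₂ r′) → walk-mono inj₂ (connected br h r r′) }
      ; labelled?  = λ w → map′ (λ { (inj₁ (h , q)) → h , inj₁ q ; (inj₂ (h , r)) → h , inj₂ r })
                                (λ { (h , inj₁ q) → inj₁ (h , q) ; (h , inj₂ r) → inj₂ (h , r) })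
                                (labelled? bq w ⊎-dec labelled? br w)
      }
      where
      across : ∀ h {u v} → Q u h → R v h → WalkIn G (Branch (Q ∪ R) h) u v
      across h q r with near q r
      ... | x , y , qx , ry , inj₁ refl =
        walk-trans (walk-mono inj₁ (connected bq h q qx)) (walk-mono inj₂ (connected br h ry r))
      ... | x , y , qx , ry , inj₂ xy =
        walk-trans (walk-mono inj₁ (connected bq h q qx))
          (step (inj₁ qx) xy (walk-mono inj₂ (connected br h ry r)))

    seg-branching : ∀ {α h} → Connected (_∈ α) → Branching (seg α h)
    seg-branching {α} {h} conn = record
      { functional = λ { (_ , refl) (_ , refl) → refl }
      ; connected  = λ { h (u∈ , refl) (v∈ , _) → walk-mono (λ w∈ → w∈ , refl) (conn u∈ v∈) }
      ; labelled?  = λ w → map′ (λ w∈ → h , w∈ , refl) (λ { (_ , w∈ , _) → w∈ }) (w ∈? α)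
      }
      where open import Data.List.Membership.DecPropositional (_≟_ {n}) using (_∈?_)

    seg-∪-branching : ∀ {Q γ h} → Branching Q → Connected (_∈ γ)
      → (∀ {w h′} → Q w h′ → ¬ w ∈ γ) → (∀ {w} → ¬ Q w h) → Branching (Q ∪ seg γ h)
    seg-∪-branching bq conn outside new = ∪-branching bq (seg-branching conn)
      (λ { q (w∈ , _) → ⊥-elim (outside q w∈) })
      (λ { q (_ , refl) → ⊥-elim (new q) })

    -- It suffices that each vertex of `R` either has one label common to `Q` and `R` or lies
    -- outside `Q`: functionality on both sides then forces all its labels to agree. This fits a
    -- child's model, which meets the parent's path only at its roots.
    attach : ∀ {Q R} → Branching Q → Branching R
      → (∀ {w h} → R w h → (∃[ h₀ ] (Q w h₀ × R w h₀)) ⊎ (∀ {h′} → ¬ Q w h′))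
      → (∀ {u v h} → Q u h → R v h → Near (Branch Q h) (Branch R h))
      → Branching (Q ∪ R)
    attach {Q} {R} bq br anchored near = ∪-branching bq br compat near
      where
      compat : ∀ {w h h′} → Q w h → R w h′ → h ≡ h′
      compat q r with anchored r
      ... | inj₁ (h₀ , q₀ , r₀) = trans (functional bq q q₀) (functional br r₀ r)
      ... | inj₂ ¬q = ⊥-elim (¬q q)

  image : ∀ {L M : Set} → (L → M) → Labelling L → Labelling M
  image f R w m = ∃[ x ] (R w x × f x ≡ m)

  image-branching : ∀ {L M : Set} {f : L → M} {R} → (∀ {x y} → f x ≡ f y → x ≡ y)
    → Branching R → Branching (image f R)
  image-branching {f = f} {R} inj br = record
    { functional = λ { (x , r , refl) (y , r′ , refl) → cong f (functional br r r′) }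
    ; connected  = conn
    ; labelled?  = λ w → map′ (λ { (h , r) → f h , h , r , refl }) (λ { (_ , h , r , _) → h , r })
                              (labelled? br w)
    }
    where
    conn : ∀ h → Connected (Branch (image f R) h)
    conn h (x , r , refl) (y , r′ , eq) with inj eq
    ... | refl = walk-mono (λ r → x , r , refl) (connected br x r r′)

  -- Labels outside the image of `f` are discarded, so a model of a larger graph yields a minor
  -- model of the part that `f` selects.
  labelling⇒minor : ∀ {L : Set} {R : Labelling L} (H : Graph) (f : V H → L)
    → (∀ {x y} → f x ≡ f y → x ≡ y) → (∀ l → Dec (∃[ x ] f x ≡ l))
    → Branching R → (∀ x → ∃[ w ] R w (f x))
    → (∀ x y → E H x y → Touching (Branch R (f x)) (Branch R (f y)))
    → H ≼ G
  labelling⇒minor {L} {R} H f inj image? br inhabited edges =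
      φ
    , (λ x → proj₁ (inhabited x) , from (proj₂ (inhabited x)))
    , (λ x u v u∈ v∈ → walk-mono from (connected br (f x) (to u∈) (to v∈)))
    , (λ x y xy → let (u , v , ru , rv , uv) = edges x y xy in u , v , from ru , from rv , uv)
    where
    label : ∀ {w} → Dec (∃[ l ] R w l) → Maybe (V H)
    label (no _) = nothing
    label (yes (l , _)) with image? l
    ... | yes (x , _) = just x
    ... | no _ = nothing

    φ : Fin n → Maybe (V H)
    φ w = label (labelled? br w)

    label-sound : ∀ {w x} (d : Dec (∃[ l ] R w l)) → label d ≡ just x → R w (f x)
    label-sound (yes (l , r)) eq with image? l
    label-sound (yes (l , r)) refl | yes (x , refl) = r

    label-complete : ∀ {w x} (d : Dec (∃[ l ] R w l)) → R w (f x) → label d ≡ just x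
    label-complete (no ¬r) r = ⊥-elim (¬r (_ , r))
    label-complete (yes (l , r′)) r with functional br r r′ | image? l
    ... | refl | yes (x , eq) = cong just (inj eq)
    ... | refl | no ¬i = ⊥-elim (¬i (_ , refl))

    to : ∀ {w x} → φ w ≡ just x → R w (f x)
    to {w} = label-sound (labelled? br w)

    from : ∀ {w x} → R w (f x) → φ w ≡ just x
    from {w} = label-complete (labelled? br w)

  -- Rooted models and the minors they yield.

  -- A model of ∇_{i+1} minus its root edge, rooted at s and t.
  record NablaModel (i : ℕ) (S : VSet) (s t : Fin n) : Set₁ where
    field
      R         : Labelling (NV i)
      branching : Branching R
      support   : ∀ {w h} → R w h → w ≡ s ⊎ w ≡ t ⊎ S w
      at-s      : R s r0
      at-t      : R t r1
      inhabited : ∀ h → ∃[ w ] R w h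
      edges     : ∀ g h → NE i g h
        → ((g ≡ r0 × h ≡ r1) ⊎ (g ≡ r1 × h ≡ r0)) ⊎ Touching (Branch R g) (Branch R h)

  -- A model of Γ_j^+ with dominating vertex "nothing", rooted at t, and with s outside the
  -- model but adjacent to the branch set of the root of Γ_j.
  record TreeModel (j : ℕ) (S : VSet) (s t : Fin n) : Set₁ where
    field
      R         : Labelling (Maybe (List Bool))
      branching : Branching R
      support   : ∀ {w h} → R w h → w ≡ t ⊎ S w
      at-t      : R t nothing
      root      : ∃[ w ] (R w (just []) × Adj G s w)
      edges     : ∀ b a → length (b ∷ a) ≤ j
        → Touching (Branch R (just a)) (Branch R (just (b ∷ a)))
      leaves    : ∀ a → length a ≡ j → Touching (Branch R (just a)) (Branch R nothing)

  -- The first copy inside ∇ has root edge from `r0` to the apex and never reaches `r1`, so the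
  -- possibly missing edge from `r0` to `r1` is not among its edges.
  nablaModel⇒minor : ∀ {i S s t} → NablaModel (suc i) S s t → Nabla i ≼ G
  nablaModel⇒minor {i} M =
    labelling⇒minor (Nabla i) emb1 emb1-injective emb1-image? branching (inhabited ∘ emb1) edges′
    where
    open NablaModel M
    edges′ : ∀ x y → NE i x y → Touching (Branch R (emb1 x)) (Branch R (emb1 y))
    edges′ x y xy with edges (emb1 x) (emb1 y) (inj₂ (inj₁ (x , y , xy , refl , refl)))
    ... | inj₁ (inj₁ (_ , eq)) = ⊥-elim (emb1-avoids-r1 y eq)
    ... | inj₁ (inj₂ (eq , _)) = ⊥-elim (emb1-avoids-r1 x eq)
    ... | inj₂ e = e

  treeModel⇒minor : ∀ {j S s t} → TreeModel j S s t → GammaPlus j ≼ G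
  treeModel⇒minor {j} M =
    labelling⇒minor (GammaPlus j) (map proj₁) address-injective address? branching inhabited edges′
    where
    open TreeModel M

    address-injective : ∀ {x y : V (GammaPlus j)} → map proj₁ x ≡ map proj₁ y → x ≡ y
    address-injective {nothing} {nothing} _ = refl
    address-injective {just (a , p)} {just (.a , q)} refl =
      cong (λ r → just (a , r)) (≤-irrelevant p q)

    -- `TreeModel j` puts no bound on the addresses in use; those longer than `j` are dropped here.
    address? : ∀ l → Dec (∃[ x ] map proj₁ x ≡ l)
    address? nothing = yes (nothing , refl)
    address? (just a) with length a ≤? j
    ... | yes p = yes (just (a , p) , refl)
    ... | no ¬p = no λ { (just (_ , p) , refl) → ¬p p }

    inhabited : ∀ (x : V (GammaPlus j)) → ∃[ w ] R w (map proj₁ x)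
    inhabited nothing = _ , at-t
    inhabited (just ([] , _)) = let (w , r , _) = root in w , r
    inhabited (just (b ∷ a , p)) = let (_ , v , _ , r , _) = edges b a p in v , r

    edges′ : ∀ (x y : V (GammaPlus j)) → E (GammaPlus j) x y
      → Touching (Branch R (map proj₁ x)) (Branch R (map proj₁ y))
    edges′ (just (a , _)) (just (_ , q)) (inj₁ (x , refl)) = edges x a q
    edges′ (just (_ , p)) (just (b , _)) (inj₂ (x , refl)) = touching-sym (edges x b p)
    edges′ (just (a , _)) nothing a≡j = leaves a a≡j
    edges′ nothing (just (b , _)) b≡j = touching-sym (leaves b b≡j)

  -- Pieces of a path.

  Avoids : VSet → List (Fin n) → Set
  Avoids S α = ∀ {w} → w ∈ α → ¬ S w

  -- The piece α of a path with end s ∈ α, where β is the other piece.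
  record Half (s : Fin n) (α β : List (Fin n)) : Set where
    field
      tail           : List (Fin n)
      end∈           : s ∈ α
      connected-all  : Connected (_∈ α)
      connected-tail : Connected (_∈ tail)
      end-or-tail    : ∀ {w} → w ∈ α → w ≡ s ⊎ w ∈ tail
      tail⊆          : ∀ {w} → w ∈ tail → w ∈ α
      end∉tail       : ¬ s ∈ tail
      touching-end   : ∀ {w} → w ∈ tail → Touching (_≡ s) (_∈ tail)
      touching-other : ∀ {w} → w ∈ tail → Touching (_∈ tail) (_∈ β)

  record Cut (S : VSet) (s t : Fin n) (α β : List (Fin n)) : Set where
    field
      left     : Half s α β
      right    : Half t β α
      junction : Touching (_∈ α) (_∈ β)
      disjoint : ∀ {w} → w ∈ α → ¬ w ∈ β
      covered  : ∀ {w} → w ∈ α ⊎ w ∈ β → w ≡ s ⊎ w ≡ t ⊎ S w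

  cut-swap : ∀ {S s t α β} → Cut S s t α β → Cut S t s β α
  cut-swap cut = record
    { left = right ; right = left ; junction = touching-sym junction
    ; disjoint = λ w∈β w∈α → disjoint w∈α w∈β
    ; covered = λ w∈ → ⊎-exchange (covered (swap w∈)) }
    where open Cut cut

  record Trisection (S : VSet) (s t : Fin n) (α β γ : List (Fin n)) : Set where
    field
      end-s       : s ∈ α
      end-t       : t ∈ γ
      connected-α : Connected (_∈ α)
      connected-β : Connected (_∈ β)
      connected-γ : Connected (_∈ γ)
      αβ          : Touching (_∈ α) (_∈ β)
      βγ          : Touching (_∈ β) (_∈ γ)
      α∩β         : ∀ {w} → w ∈ α → ¬ w ∈ β
      α∩γ         : ∀ {w} → w ∈ α → ¬ w ∈ γ
      β∩γ         : ∀ {w} → w ∈ β → ¬ w ∈ γ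
      coveredα    : ∀ {w} → w ∈ α → w ≡ s ⊎ w ≡ t ⊎ S w
      coveredβ    : ∀ {w} → w ∈ β → w ≡ s ⊎ w ≡ t ⊎ S w
      coveredγ    : ∀ {w} → w ∈ γ → w ≡ s ⊎ w ≡ t ⊎ S w

  trisection-swap : ∀ {S s t α β γ} → Trisection S s t α β γ → Trisection S t s γ β α
  trisection-swap tri = record
    { end-s = end-t ; end-t = end-s
    ; connected-α = connected-γ ; connected-β = connected-β ; connected-γ = connected-α
    ; αβ = touching-sym βγ ; βγ = touching-sym αβ
    ; α∩β = λ x y → β∩γ y x ; α∩γ = λ x y → α∩γ y x ; β∩γ = λ x y → α∩β y x
    ; coveredα = ⊎-exchange ∘ coveredγ ; coveredβ = ⊎-exchange ∘ coveredβ ; coveredγ = ⊎-exchange ∘ coveredα }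
    where open Trisection tri

  -- Building ∇-models.

  tri-edges : ∀ {L : Set} {R : Labelling L} {x y z : L}
    → Touching (Branch R x) (Branch R z) → Touching (Branch R z) (Branch R y)
    → ∀ g h → Tri x y z g h
    → ((g ≡ x × h ≡ y) ⊎ (g ≡ y × h ≡ x)) ⊎ Touching (Branch R g) (Branch R h)
  tri-edges xz zy _ _ (inj₁ e) = inj₁ (inj₁ e)
  tri-edges xz zy _ _ (inj₂ (inj₁ e)) = inj₁ (inj₂ e)
  tri-edges xz zy _ _ (inj₂ (inj₂ (inj₁ (refl , refl)))) = inj₂ xz
  tri-edges xz zy _ _ (inj₂ (inj₂ (inj₂ (inj₁ (refl , refl))))) = inj₂ (touching-sym xz)
  tri-edges xz zy _ _ (inj₂ (inj₂ (inj₂ (inj₂ (inj₁ (refl , refl)))))) = inj₂ (touching-sym zy)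
  tri-edges xz zy _ _ (inj₂ (inj₂ (inj₂ (inj₂ (inj₂ (refl , refl)))))) = inj₂ zy

  -- `c` names the middle piece: the third vertex of ∇_1 in `nabla-base`, the new apex in
  -- `nabla-join`.
  module Three {S s t α β γ} (tri : Trisection S s t α β γ) {i : ℕ} (c : NR i) where
    open Trisection tri

    Q : Labelling (NV i)
    Q = (seg α r0 ∪ seg β (inj₂ c)) ∪ seg γ r1

    Q-branching : Branching Q
    Q-branching = seg-∪-branching
      (seg-∪-branching (seg-branching connected-α) connected-β
        (λ { (w∈ , _) → α∩β w∈ }) (λ { (_ , ()) }))
      connected-γ
      (λ { (inj₁ (w∈ , _)) → α∩γ w∈ ; (inj₂ (w∈ , _)) → β∩γ w∈ })
      (λ { (inj₁ (_ , ())) ; (inj₂ (_ , ())) })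

    Q-support : ∀ {w h} → Q w h → w ≡ s ⊎ w ≡ t ⊎ S w
    Q-support (inj₁ (inj₁ (w∈ , _))) = coveredα w∈
    Q-support (inj₁ (inj₂ (w∈ , _))) = coveredβ w∈
    Q-support (inj₂ (w∈ , _)) = coveredγ w∈

    Q-avoids : ∀ {T : VSet} → Avoids T α → Avoids T β → Avoids T γ → ∀ {w h} → Q w h → ¬ T w
    Q-avoids a b c (inj₁ (inj₁ (w∈ , _))) = a w∈
    Q-avoids a b c (inj₁ (inj₂ (w∈ , _))) = b w∈
    Q-avoids a b c (inj₂ (w∈ , _)) = c w∈

    r0-apex : Touching (Branch Q r0) (Branch Q (inj₂ c))
    r0-apex = touching-mono (λ w∈ → inj₁ (inj₁ (w∈ , refl))) (λ w∈ → inj₁ (inj₂ (w∈ , refl))) αβ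

    apex-r1 : Touching (Branch Q (inj₂ c)) (Branch Q r1)
    apex-r1 = touching-mono (λ w∈ → inj₁ (inj₂ (w∈ , refl))) (λ w∈ → inj₂ (w∈ , refl)) βγ

  nabla-base : ∀ {S s t α β γ} → Trisection S s t α β γ → NablaModel 0 S s t
  nabla-base tri = record
    { R = Q ; branching = Q-branching ; support = Q-support
    ; at-s = inj₁ (inj₁ (end-s , refl)) ; at-t = inj₂ (end-t , refl)
    ; inhabited = λ { (inj₁ zero)       → _ , inj₁ (inj₁ (end-s , refl))
                    ; (inj₁ (suc zero)) → _ , inj₂ (end-t , refl)
                    ; (inj₂ tt)         → let (_ , v , _ , q , _) = r0-apex in v , q }
    ; edges = tri-edges r0-apex apex-r1 }
    where
    open Trisection tri
    open Three tri {0} tt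

  -- The root edges missing in the copies run from `r0` and `r1` to the new apex, and the path
  -- supplies both where `α` meets `β` and `β` meets `γ`. Since `emb2` sends `r0` to `r1` and `r1`
  -- to the apex, the second model is taken with roots in the order `d`, `c`.
  nabla-join : ∀ {S S₁ S₂ s t α β γ i a b c d} → Trisection S s t α β γ
    → Avoids S₁ α → Avoids S₁ β → Avoids S₁ γ → Avoids S₂ α → Avoids S₂ β → Avoids S₂ γ
    → (∀ {w} → S₁ w → ¬ S₂ w) → (∀ {w} → S₁ w → S w) → (∀ {w} → S₂ w → S w)
    → a ∈ α → b ∈ β → c ∈ β → d ∈ γ
    → NablaModel i S₁ a b → NablaModel i S₂ d c → NablaModel (suc i) S s t
  nabla-join {S} {S₁} {S₂} {s} {t} {α} {β} {γ} {i} {a} {b} {c} {d}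
    tri α₁ β₁ γ₁ α₂ β₂ γ₂ S₁∩S₂ S₁⊆S S₂⊆S a∈ b∈ c∈ d∈ M₁ M₂ = record
    { R = R ; branching = R-branching ; support = R-support
    ; at-s = inj₁ (inj₁ (inj₁ (inj₁ (end-s , refl)))) ; at-t = inj₁ (inj₁ (inj₂ (end-t , refl)))
    ; inhabited = R-inhabited ; edges = R-edges }
    where
    open Trisection tri
    open Three tri {suc i} (inj₁ tt)
    module M₁ = NablaModel M₁
    module M₂ = NablaModel M₂

    I₁ I₂ R : Labelling (NV (suc i))
    I₁ = image emb1 M₁.R
    I₂ = image emb2 M₂.R
    R = (Q ∪ I₁) ∪ I₂

    a-r0 : Q a r0
    a-r0 = inj₁ (inj₁ (a∈ , refl))

    b-apex : Q b apex
    b-apex = inj₁ (inj₂ (b∈ , refl))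

    c-apex : Q c apex
    c-apex = inj₁ (inj₂ (c∈ , refl))

    d-r1 : Q d r1
    d-r1 = inj₂ (d∈ , refl)

    I₁-near : ∀ {u v h} → Q u h → I₁ v h → Near (Branch Q h) (Branch I₁ h)
    I₁-near (inj₁ (inj₁ (_ , refl))) _ = a , a , a-r0 , (r0 , M₁.at-s , refl) , inj₁ refl
    I₁-near (inj₁ (inj₂ (_ , refl))) _ = b , b , b-apex , (r1 , M₁.at-t , refl) , inj₁ refl
    I₁-near (inj₂ (_ , refl)) (x , _ , eq) = ⊥-elim (emb1-avoids-r1 x eq)

    I₁-anchored : ∀ {w h} → I₁ w h → (∃[ h₀ ] (Q w h₀ × I₁ w h₀)) ⊎ (∀ {h′} → ¬ Q w h′)
    I₁-anchored (x , r , refl) with M₁.support r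
    ... | inj₁ refl = inj₁ (r0 , a-r0 , (r0 , M₁.at-s , refl))
    ... | inj₂ (inj₁ refl) = inj₁ (apex , b-apex , (r1 , M₁.at-t , refl))
    ... | inj₂ (inj₂ w∈S₁) = inj₂ λ q → Q-avoids α₁ β₁ γ₁ q w∈S₁

    I₂-near : ∀ {u v h} → (Q ∪ I₁) u h → I₂ v h → Near (Branch (Q ∪ I₁) h) (Branch I₂ h)
    I₂-near (inj₁ (inj₁ (inj₁ (_ , refl)))) (y , _ , eq) = ⊥-elim (emb2-avoids-r0 y eq)
    I₂-near (inj₁ (inj₁ (inj₂ (_ , refl)))) _ =
      c , c , inj₁ c-apex , (r1 , M₂.at-t , refl) , inj₁ refl
    I₂-near (inj₁ (inj₂ (_ , refl))) _ =
      d , d , inj₁ d-r1 , (r0 , M₂.at-s , refl) , inj₁ refl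
    -- A label used by both copies is the apex, and there the second copy meets `β` at `c`.
    I₂-near (inj₂ (x , _ , refl)) (y , _ , eq) with emb-meet x y (≡-sym eq)
    ... | eq′ with trans (≡-sym eq) eq′
    ... | eq″ rewrite eq″ = c , c , inj₁ c-apex , (r1 , M₂.at-t , refl) , inj₁ refl

    I₂-anchored : ∀ {w h} → I₂ w h
      → (∃[ h₀ ] ((Q ∪ I₁) w h₀ × I₂ w h₀)) ⊎ (∀ {h′} → ¬ (Q ∪ I₁) w h′)
    I₂-anchored {w} (_ , r , _) with M₂.support r
    ... | inj₁ refl = inj₁ (r1 , inj₁ d-r1 , (r0 , M₂.at-s , refl))
    ... | inj₂ (inj₁ refl) = inj₁ (apex , inj₁ c-apex , (r1 , M₂.at-t , refl))
    ... | inj₂ (inj₂ w∈S₂) = inj₂ outside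
      where
      outside : ∀ {h′} → ¬ (Q ∪ I₁) w h′
      outside (inj₁ q) = Q-avoids α₂ β₂ γ₂ q w∈S₂
      outside (inj₂ (_ , r₁ , _)) with M₁.support r₁
      ... | inj₁ refl = α₂ a∈ w∈S₂
      ... | inj₂ (inj₁ refl) = β₂ b∈ w∈S₂
      ... | inj₂ (inj₂ w∈S₁) = S₁∩S₂ w∈S₁ w∈S₂

    R-branching : Branching R
    R-branching = attach
      (attach Q-branching (image-branching emb1-injective M₁.branching) I₁-anchored I₁-near)
      (image-branching emb2-injective M₂.branching) I₂-anchored I₂-near

    R-support : ∀ {w h} → R w h → w ≡ s ⊎ w ≡ t ⊎ S w
    R-support (inj₁ (inj₁ q)) = Q-support q
    R-support (inj₁ (inj₂ (_ , r , _))) with M₁.support r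
    ... | inj₁ refl = coveredα a∈
    ... | inj₂ (inj₁ refl) = coveredβ b∈
    ... | inj₂ (inj₂ w∈) = inj₂ (inj₂ (S₁⊆S w∈))
    R-support (inj₂ (_ , r , _)) with M₂.support r
    ... | inj₁ refl = coveredγ d∈
    ... | inj₂ (inj₁ refl) = coveredβ c∈
    ... | inj₂ (inj₂ w∈) = inj₂ (inj₂ (S₂⊆S w∈))

    R-inhabited : ∀ h → ∃[ w ] R w h
    R-inhabited (inj₁ zero) = _ , inj₁ (inj₁ a-r0)
    R-inhabited (inj₁ (suc zero)) = _ , inj₁ (inj₁ d-r1)
    R-inhabited (inj₂ (inj₁ tt)) = _ , inj₁ (inj₁ b-apex)
    R-inhabited (inj₂ (inj₂ (inj₁ x))) =
      let (w , r) = M₁.inhabited (inj₂ x) in w , inj₁ (inj₂ (inj₂ x , r , refl))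
    R-inhabited (inj₂ (inj₂ (inj₂ x))) =
      let (w , r) = M₂.inhabited (inj₂ x) in w , inj₂ (inj₂ x , r , refl)

    from-Q : ∀ {g h} → Touching (Branch Q g) (Branch Q h) → Touching (Branch R g) (Branch R h)
    from-Q = touching-mono (inj₁ ∘ inj₁) (inj₁ ∘ inj₁)

    R-edges : ∀ g h → NE (suc i) g h
      → ((g ≡ r0 × h ≡ r1) ⊎ (g ≡ r1 × h ≡ r0)) ⊎ Touching (Branch R g) (Branch R h)
    R-edges g h (inj₁ e) = tri-edges (from-Q r0-apex) (from-Q apex-r1) g h e
    R-edges _ _ (inj₂ (inj₁ (x , y , xy , refl , refl))) with M₁.edges x y xy
    -- The root edge absent from the child's model is realised on the path.
    ... | inj₁ (inj₁ (refl , refl)) = inj₂ (from-Q r0-apex)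
    ... | inj₁ (inj₂ (refl , refl)) = inj₂ (from-Q (touching-sym r0-apex))
    ... | inj₂ e = inj₂ (touching-mono (λ r → inj₁ (inj₂ (x , r , refl)))
                                       (λ r → inj₁ (inj₂ (y , r , refl))) e)
    R-edges _ _ (inj₂ (inj₂ (x , y , xy , refl , refl))) with M₂.edges x y xy
    ... | inj₁ (inj₁ (refl , refl)) = inj₂ (from-Q (touching-sym apex-r1))
    ... | inj₁ (inj₂ (refl , refl)) = inj₂ (from-Q apex-r1)
    ... | inj₂ e = inj₂ (touching-mono (λ r → inj₂ (x , r , refl)) (λ r → inj₂ (y , r , refl)) e)

  -- The piece `α` is absorbed into the branch set of `r0` at `a`, and `β` into that of `r1` at `b`;
  -- this moves the roots from `a`, `b` to `s`, `t`.
  nabla-extend : ∀ {S S₁ s t α β i a b} → Cut S s t α β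
    → Avoids S₁ α → Avoids S₁ β → (∀ {w} → S₁ w → S w) → a ∈ α → b ∈ β
    → NablaModel i S₁ a b → NablaModel i S s t
  nabla-extend {S} {S₁} {s} {t} {α} {β} {i} {a} {b} cut α₁ β₁ S₁⊆S a∈ b∈ M = record
    { R = R
    ; branching = attach Q-branching M.branching anchored near
    ; support = support
    ; at-s = inj₁ (inj₁ (Half.end∈ left , refl)) ; at-t = inj₁ (inj₂ (Half.end∈ right , refl))
    ; inhabited = λ h → let (w , r) = M.inhabited h in w , inj₂ r
    ; edges = edges }
    where
    open Cut cut
    module M = NablaModel M

    Q R : Labelling (NV i)
    Q = seg α r0 ∪ seg β r1
    R = Q ∪ M.R

    Q-branching : Branching Q
    Q-branching = seg-∪-branching (seg-branching (Half.connected-all left))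
      (Half.connected-all right) (λ { (w∈ , _) → disjoint w∈ }) (λ { (_ , ()) })

    anchored : ∀ {w h} → M.R w h → (∃[ h₀ ] (Q w h₀ × M.R w h₀)) ⊎ (∀ {h′} → ¬ Q w h′)
    anchored r with M.support r
    ... | inj₁ refl = inj₁ (r0 , inj₁ (a∈ , refl) , M.at-s)
    ... | inj₂ (inj₁ refl) = inj₁ (r1 , inj₂ (b∈ , refl) , M.at-t)
    ... | inj₂ (inj₂ w∈S₁) = inj₂ λ { (inj₁ (w∈ , _)) → α₁ w∈ w∈S₁ ; (inj₂ (w∈ , _)) → β₁ w∈ w∈S₁ }

    near : ∀ {u v h} → Q u h → M.R v h → Near (Branch Q h) (Branch M.R h)
    near (inj₁ (_ , refl)) _ = a , a , inj₁ (a∈ , refl) , M.at-s , inj₁ refl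
    near (inj₂ (_ , refl)) _ = b , b , inj₂ (b∈ , refl) , M.at-t , inj₁ refl

    support : ∀ {w h} → R w h → w ≡ s ⊎ w ≡ t ⊎ S w
    support (inj₁ (inj₁ (w∈ , _))) = covered (inj₁ w∈)
    support (inj₁ (inj₂ (w∈ , _))) = covered (inj₂ w∈)
    support (inj₂ r) with M.support r
    ... | inj₁ refl = covered (inj₁ a∈)
    ... | inj₂ (inj₁ refl) = covered (inj₂ b∈)
    ... | inj₂ (inj₂ w∈) = inj₂ (inj₂ (S₁⊆S w∈))

    edges : ∀ g h → NE i g h
      → ((g ≡ r0 × h ≡ r1) ⊎ (g ≡ r1 × h ≡ r0)) ⊎ Touching (Branch R g) (Branch R h)
    edges g h e with M.edges g h e
    ... | inj₁ root = inj₁ root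
    ... | inj₂ e′ = inj₂ (touching-mono inj₂ inj₂ e′)

  -- Building models of Γ_j^+.

  β-support : ∀ {S s t α β} → Cut S s t α β → ∀ {w} → w ∈ β → w ≡ t ⊎ S w
  β-support cut w∈ with Cut.covered cut (inj₂ w∈)
  ... | inj₁ refl = ⊥-elim (Cut.disjoint cut (Half.end∈ (Cut.left cut)) w∈)
  ... | inj₂ ok = ok

  -- `α` without `s` becomes the branch set of the root and `β` goes into the dominating vertex. The
  -- tail of a half may be empty, and `w₀` excludes this.
  module Rooted {S s t α β} (cut : Cut S s t α β) {w₀} (w₀∈ : w₀ ∈ Half.tail (Cut.left cut)) where
    open Cut cut
    open Half left using (tail; tail⊆; end∉tail)

    Q : Labelling (Maybe (List Bool))
    Q = seg tail (just []) ∪ seg β nothing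

    Q-branching : Branching Q
    Q-branching = seg-∪-branching (seg-branching (Half.connected-tail left))
      (Half.connected-all right) (λ { (w∈ , _) → disjoint (tail⊆ w∈) }) (λ { (_ , ()) })

    Q-avoids : ∀ {T : VSet} → Avoids T α → Avoids T β → ∀ {w h} → Q w h → ¬ T w
    Q-avoids a b (inj₁ (w∈ , _)) = a (tail⊆ w∈)
    Q-avoids a b (inj₂ (w∈ , _)) = b w∈

    Q-support : ∀ {w h} → Q w h → w ≡ t ⊎ S w
    Q-support (inj₂ (w∈ , _)) = β-support cut w∈
    Q-support (inj₁ (w∈ , _)) with covered (inj₁ (tail⊆ w∈))
    ... | inj₁ refl = ⊥-elim (end∉tail w∈)
    ... | inj₂ ok = ok

    Q-root : ∃[ w ] (Q w (just []) × Adj G s w)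
    Q-root with Half.touching-end left w₀∈
    ... | _ , v , refl , v∈ , sv = v , inj₁ (v∈ , refl) , sv

    Q-leaf : Touching (Branch Q (just [])) (Branch Q nothing)
    Q-leaf = touching-mono (λ w∈ → inj₁ (w∈ , refl)) (λ w∈ → inj₂ (w∈ , refl))
      (Half.touching-other left w₀∈)

  tree-base : ∀ {S s t α β} (cut : Cut S s t α β) {w} → w ∈ Half.tail (Cut.left cut)
    → TreeModel 0 S s t
  tree-base cut w∈ = record
    { R = Q ; branching = Q-branching ; support = Q-support
    ; at-t = inj₂ (Half.end∈ (Cut.right cut) , refl) ; root = Q-root
    ; edges = λ { _ _ () } ; leaves = λ { [] _ → Q-leaf } }
    where open Rooted cut w∈

  -- If `a` is `s`, the root of the given model is already adjacent to `s` and only `β` is added, to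
  -- the dominating vertex. Otherwise the tail of `α` joins the root's branch set and brings the
  -- adjacency to `s`.
  tree-extend : ∀ {S S₁ s t α β j a b} → Cut S s t α β
    → Avoids S₁ α → Avoids S₁ β → (∀ {w} → S₁ w → S w) → a ∈ α → b ∈ β
    → TreeModel j S₁ a b → TreeModel j S s t
  tree-extend {S} {S₁} {s} {t} {α} {β} {j} {a} {b} cut α₁ β₁ S₁⊆S a∈ b∈ M =
    go (Half.end-or-tail left a∈)
    where
    open Cut cut
    module M = TreeModel M

    M-support : ∀ {w h} → M.R w h → w ≡ t ⊎ S w
    M-support r with M.support r
    ... | inj₁ refl = β-support cut b∈
    ... | inj₂ w∈ = inj₂ (S₁⊆S w∈)

    go : a ≡ s ⊎ a ∈ Half.tail left → TreeModel j S s t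
    go (inj₁ refl) = record
      { R = seg β nothing ∪ M.R
      ; branching = attach (seg-branching (Half.connected-all right)) M.branching
          anchored (λ { (_ , refl) _ → b , b , (b∈ , refl) , M.at-t , inj₁ refl })
      ; support = λ { (inj₁ (w∈ , _)) → β-support cut w∈ ; (inj₂ r) → M-support r }
      ; at-t = inj₁ (Half.end∈ right , refl)
      ; root = let (w , r , e) = M.root in w , inj₂ r , e
      ; edges = λ b a p → touching-mono inj₂ inj₂ (M.edges b a p)
      ; leaves = λ a p → touching-mono inj₂ inj₂ (M.leaves a p) }
      where
      anchored : ∀ {w h} → M.R w h
        → (∃[ h₀ ] (seg β nothing w h₀ × M.R w h₀)) ⊎ (∀ {h′} → ¬ seg β nothing w h′)
      anchored r with M.support r
      ... | inj₁ refl = inj₁ (nothing , (b∈ , refl) , M.at-t)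
      ... | inj₂ w∈S₁ = inj₂ λ { (w∈ , _) → β₁ w∈ w∈S₁ }
    go (inj₂ a∈tail) = record
      { R = Q ∪ M.R
      ; branching = attach Q-branching M.branching anchored near
      ; support = λ { (inj₁ q) → Q-support q ; (inj₂ r) → M-support r }
      ; at-t = inj₁ (inj₂ (Half.end∈ right , refl))
      ; root = let (w , q , e) = Q-root in w , inj₁ q , e
      ; edges = λ b a p → touching-mono inj₂ inj₂ (M.edges b a p)
      ; leaves = λ a p → touching-mono inj₂ inj₂ (M.leaves a p) }
      where
      open Rooted cut a∈tail

      anchored : ∀ {w h} → M.R w h → (∃[ h₀ ] (Q w h₀ × M.R w h₀)) ⊎ (∀ {h′} → ¬ Q w h′)
      anchored r with M.support r
      ... | inj₁ refl = inj₁ (nothing , inj₂ (b∈ , refl) , M.at-t)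
      ... | inj₂ w∈S₁ = inj₂ λ q → Q-avoids α₁ β₁ q w∈S₁

      near : ∀ {u v h} → Q u h → M.R v h → Near (Branch Q h) (Branch M.R h)
      -- `a` lies outside the child's model but is adjacent to its root, so the tail merges with
      -- that root across an edge.
      near (inj₁ (_ , refl)) _ =
        let (w , r , aw) = M.root in a , w , inj₁ (a∈tail , refl) , r , inj₂ aw
      near (inj₂ (_ , refl)) _ = b , b , inj₂ (b∈ , refl) , M.at-t , inj₁ refl

  -- Both `a c` lie in the tail and are adjacent to the roots of the two child models, so the tail
  -- is a common parent of these roots. The two dominating vertices merge through `β`.
  tree-join : ∀ {S s t α β j} (cut : Cut S s t α β) (Sᶜ : Bool → VSet)
    → (∀ c → Avoids (Sᶜ c) α) → (∀ c → Avoids (Sᶜ c) β)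
    → (∀ {w} → Sᶜ false w → ¬ Sᶜ true w) → (∀ c {w} → Sᶜ c w → S w)
    → (a b : Bool → Fin n) → (∀ c → a c ∈ Half.tail (Cut.left cut)) → (∀ c → b c ∈ β)
    → (∀ c → TreeModel j (Sᶜ c) (a c) (b c)) → TreeModel (suc j) S s t
  tree-join {S} {s} {t} {α} {β} {j} cut Sᶜ αᶜ βᶜ disj Sᶜ⊆S a b a∈ b∈ M = record
    { R = R ; branching = R-branching ; support = R-support
    ; at-t = inj₁ (inj₁ (inj₂ (Half.end∈ right , refl)))
    ; root = let (w , q , e) = Q-root in w , inj₁ (inj₁ q) , e
    ; edges = R-edges ; leaves = R-leaves }
    where
    open Cut cut using (left; right)
    open Rooted cut (a∈ false)
    module M c = TreeModel (M c)

    I : Bool → Labelling (Maybe (List Bool))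
    I c = image (graft c) (M.R c)

    R : Labelling (Maybe (List Bool))
    R = (Q ∪ I false) ∪ I true

    b-nothing : ∀ c → Q (b c) nothing
    b-nothing c = inj₂ (b∈ c , refl)

    I-nothing : ∀ c → I c (b c) nothing
    I-nothing c = nothing , M.at-t c , refl

    I-branching : ∀ c → Branching (I c)
    I-branching c = image-branching graft-injective (M.branching c)

    Q-near : ∀ c {u v h} → Q u h → I c v h → Near (Branch Q h) (Branch (I c) h)
    Q-near c (inj₁ (_ , refl)) (x , _ , eq) = ⊥-elim (graft-avoids-root x eq)
    Q-near c (inj₂ (_ , refl)) _ = b c , b c , b-nothing c , I-nothing c , inj₁ refl

    false-anchored : ∀ {w h} → I false w h
      → (∃[ h₀ ] (Q w h₀ × I false w h₀)) ⊎ (∀ {h′} → ¬ Q w h′)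
    false-anchored (_ , r , _) with M.support false r
    ... | inj₁ refl = inj₁ (nothing , b-nothing false , I-nothing false)
    ... | inj₂ w∈S = inj₂ λ q → Q-avoids (αᶜ false) (βᶜ false) q w∈S

    true-anchored : ∀ {w h} → I true w h
      → (∃[ h₀ ] ((Q ∪ I false) w h₀ × I true w h₀)) ⊎ (∀ {h′} → ¬ (Q ∪ I false) w h′)
    true-anchored {w} (_ , r , _) with M.support true r
    ... | inj₁ refl = inj₁ (nothing , inj₁ (b-nothing true) , I-nothing true)
    ... | inj₂ w∈S = inj₂ outside
      where
      outside : ∀ {h′} → ¬ (Q ∪ I false) w h′
      outside (inj₁ q) = Q-avoids (αᶜ true) (βᶜ true) q w∈S
      outside (inj₂ (_ , r′ , _)) with M.support false r′
      ... | inj₁ refl = βᶜ true (b∈ false) w∈S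
      ... | inj₂ w∈S′ = disj w∈S′ w∈S

    true-near : ∀ {u v h} → (Q ∪ I false) u h → I true v h
      → Near (Branch (Q ∪ I false) h) (Branch (I true) h)
    true-near (inj₁ q) i with Q-near true q i
    ... | x , y , qx , iy , xy = x , y , inj₁ qx , iy , xy
    true-near (inj₂ (x , _ , refl)) (y , _ , eq)
      with trans (≡-sym eq) (graft-meet (λ ()) x y (≡-sym eq))
    ... | eq′ rewrite eq′ =
      b true , b true , inj₁ (b-nothing true) , I-nothing true , inj₁ refl

    R-branching : Branching R
    R-branching = attach
      (attach Q-branching (I-branching false) false-anchored (Q-near false))
      (I-branching true) true-anchored true-near

    I-support : ∀ c {w h} → I c w h → w ≡ t ⊎ S w
    I-support c (_ , r , _) with M.support c r
    ... | inj₁ refl = β-support cut (b∈ c)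
    ... | inj₂ w∈S = inj₂ (Sᶜ⊆S c w∈S)

    R-support : ∀ {w h} → R w h → w ≡ t ⊎ S w
    R-support (inj₁ (inj₁ q)) = Q-support q
    R-support (inj₁ (inj₂ i)) = I-support false i
    R-support (inj₂ i) = I-support true i

    I⊆R : ∀ c {w h} → I c w h → R w h
    I⊆R false i = inj₁ (inj₂ i)
    I⊆R true i = inj₂ i

    R-edges : ∀ x y → length (x ∷ y) ≤ suc j → Touching (Branch R (just y)) (Branch R (just (x ∷ y)))
    -- The last entry of an address is the first turn from the root, so it tells which child model
    -- the edge comes from; the empty address is the new root.
    R-edges x y p with initLast y
    ... | [] = let (w , r , e) = M.root x in
      a x , w , root-at x , I⊆R x (just [] , r , refl) , e
      where
      root-at : ∀ c → R (a c) (just [])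
      root-at c = inj₁ (inj₁ (inj₁ (a∈ c , refl)))
    ... | y′ ∷ʳ′ c = touching-mono (λ r → I⊆R c (just y′ , r , refl))
      (λ r → I⊆R c (just (x ∷ y′) , r , refl))
      (M.edges c x y′ (subst (_≤ j) (length-∷ʳ y′ c) (s≤s⁻¹ p)))

    R-leaves : ∀ y → length y ≡ suc j → Touching (Branch R (just y)) (Branch R nothing)
    R-leaves y p with initLast y
    R-leaves .[] () | []
    ... | y′ ∷ʳ′ c = touching-mono (λ r → I⊆R c (just y′ , r , refl))
      (λ r → I⊆R c (nothing , r , refl))
      (M.leaves c y′ (suc-injective (trans (≡-sym (length-∷ʳ y′ c)) p)))

  -- Outcomes available along a single path.

  -- The structure found in a subtree whose ear has ends s and t, with one parameter for each
  -- of the three kinds of vertices.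
  Outcome : ℕ → ℕ → ℕ → VSet → Fin n → Fin n → Set₁
  Outcome i j k S s t =
    (NablaModel i S s t × NablaModel i S t s) ⊎ TreeModel j S s t ⊎ TreeModel k S t s

  -- Reversing the path exchanges the two tree kinds and hence `j` and `k`. The ∇ kind carries both
  -- orientations, which avoids a mirror automorphism of ∇.
  outcome-swap : ∀ {i j k S s t} → Outcome i j k S s t → Outcome i k j S t s
  outcome-swap (inj₁ (M , N)) = inj₁ (N , M)
  outcome-swap (inj₂ o)       = inj₂ (swap o)

  half-left : ∀ {s α β b} → Unique (s ∷ α ++ β) → Linked (Adj G) (s ∷ α ++ β) → b ∈ β
    → Half s (s ∷ α) β
  half-left {s} {α} {β} unique linked b∈ = record
    { tail           = α
    ; end∈           = here refl
    ; connected-all  = linked-connected (proj₁ (linked-++ (s ∷ α) linked))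
    ; connected-tail = linked-connected (proj₁ (linked-++ α (proj₂ (linked-++ [ s ] linked))))
    ; end-or-tail    = λ { (here refl) → inj₁ refl ; (there w∈) → inj₂ w∈ }
    ; tail⊆          = there
    ; end∉tail       = unique-disjoint [ s ] unique (here refl) ∘ ∈-++⁺ˡ
    ; touching-end   = λ w∈ → touching-mono (λ { (here eq) → eq }) id
        (linked-junction [ s ] (proj₁ (linked-++ (s ∷ α) linked)) (here refl) w∈)
    ; touching-other = λ w∈ → linked-junction α (proj₂ (linked-++ [ s ] linked)) w∈ b∈ }

  half-right : ∀ {t α β a} → Unique (α ++ (β ∷ʳ t)) → Linked (Adj G) (α ++ (β ∷ʳ t)) → a ∈ α
    → Half t (β ∷ʳ t) α
  half-right {t} {α} {β} unique linked a∈ = record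
    { tail           = β
    ; end∈           = ∈-++⁺ʳ β (here refl)
    ; connected-all  = linked-connected linkedβt
    ; connected-tail = linked-connected (proj₁ (linked-++ β linkedβt))
    ; end-or-tail    = λ w∈ → end-or-tail (∈-++⁻ β w∈)
    ; tail⊆          = ∈-++⁺ˡ
    ; end∉tail       = λ t∈ → unique-disjoint (α ++ β)
        (subst Unique (≡-sym (++-assoc α β [ t ])) unique) (∈-++⁺ʳ α t∈) (here refl)
    ; touching-end   = λ w∈ → touching-mono (λ { (here eq) → eq }) id
        (touching-sym (linked-junction β linkedβt w∈ (here refl)))
    ; touching-other = λ w∈ → touching-sym (linked-junction α
        (proj₁ (linked-++ (α ++ β) (subst (Linked (Adj G)) (≡-sym (++-assoc α β [ t ])) linked)))
        a∈ w∈) }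
    where
    linkedβt : Linked (Adj G) (β ∷ʳ t)
    linkedβt = proj₂ (linked-++ α linked)
    end-or-tail : ∀ {w} → w ∈ β ⊎ w ∈ [ t ] → w ≡ t ⊎ w ∈ β
    end-or-tail (inj₁ w∈) = inj₂ w∈
    end-or-tail (inj₂ (here eq)) = inj₁ eq

  record PathBetween (S : VSet) (s t : Fin n) (p : List (Fin n)) : Set where
    field
      inner      : List (Fin n)
      shape      : p ≡ s ∷ inner ∷ʳ t
      inhabitant : ∃[ w ] w ∈ inner
      unique     : Unique p
      linked     : Linked (Adj G) p
      covered    : ∀ {w} → w ∈ p → w ≡ s ⊎ w ≡ t ⊎ S w

  module _ {S s t p} (path : PathBetween S s t p) where
    open PathBetween path

    -- Both pieces are nonempty, so comparing with `shape` forces the first entry of `α` to be `s`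
    -- and the last entry of `β` to be `t`.
    cut-path : ∀ {α β a b} → p ≡ α ++ β → a ∈ α → b ∈ β → Cut S s t α β
    cut-path {y ∷ α} {β} p≡ a∈ b∈ with initLast β
    ... | β′ ∷ʳ′ z with ∷-injective (trans (≡-sym shape) p≡)
                      | ∷ʳ-injectiveʳ (s ∷ inner) (y ∷ α ++ β′)
                          (trans (trans (≡-sym shape) p≡) (≡-sym (++-assoc (y ∷ α) β′ [ z ])))
    ... | refl , _ | refl = record
      { left = half-left (subst Unique p≡ unique) (subst (Linked (Adj G)) p≡ linked) b∈
      ; right = half-right (subst Unique p≡ unique) (subst (Linked (Adj G)) p≡ linked) a∈
      ; junction = linked-junction (y ∷ α) (subst (Linked (Adj G)) p≡ linked) a∈ b∈
      ; disjoint = unique-disjoint (y ∷ α) (subst Unique p≡ unique)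
      ; covered = λ { (inj₁ w∈) → covered (subst (_ ∈_) (≡-sym p≡) (∈-++⁺ˡ w∈))
                    ; (inj₂ w∈) → covered (subst (_ ∈_) (≡-sym p≡) (∈-++⁺ʳ (y ∷ α) w∈)) } }

    trisect : ∀ {α β γ a b c} → p ≡ α ++ (β ++ γ) → a ∈ α → b ∈ β → c ∈ γ → Trisection S s t α β γ
    trisect {α} {β} {γ} p≡ a∈ b∈ c∈ = record
      { end-s = Half.end∈ (left first) ; end-t = Half.end∈ (right second)
      ; connected-α = Half.connected-all (left first)
      ; connected-β = linked-connected (proj₁ (linked-++ β (proj₂ (linked-++ α linked₁))))
      ; connected-γ = Half.connected-all (right second)
      ; αβ = linked-junction α (proj₁ (linked-++ (α ++ β) linked₂)) a∈ b∈
      ; βγ = linked-junction β (proj₂ (linked-++ α linked₁)) b∈ c∈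
      ; α∩β = λ w∈ → disjoint first w∈ ∘ ∈-++⁺ˡ
      ; α∩γ = λ w∈ → disjoint first w∈ ∘ ∈-++⁺ʳ β
      ; β∩γ = disjoint second ∘ ∈-++⁺ʳ α
      ; coveredα = covered′ first ∘ inj₁
      ; coveredβ = covered′ first ∘ inj₂ ∘ ∈-++⁺ˡ
      ; coveredγ = covered′ second ∘ inj₂ }
      where
      open Cut renaming (covered to covered′)
      p≡′ : p ≡ (α ++ β) ++ γ
      p≡′ = trans p≡ (≡-sym (++-assoc α β γ))
      linked₁ : Linked (Adj G) (α ++ (β ++ γ))
      linked₁ = subst (Linked (Adj G)) p≡ linked
      linked₂ : Linked (Adj G) ((α ++ β) ++ γ)
      linked₂ = subst (Linked (Adj G)) p≡′ linked
      first : Cut S s t α (β ++ γ)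
      first = cut-path p≡ a∈ (∈-++⁺ˡ b∈)
      second : Cut S s t (α ++ β) γ
      second = cut-path p≡′ (∈-++⁺ˡ a∈) c∈

    -- ∇_1 without its root edge is a path on three vertices; the pieces are `s`, the interior and
    -- `t`.
    nabla-zero : ∀ {j k} → Outcome 0 j k S s t
    nabla-zero = inj₁ (nabla-base tri , nabla-base (trisection-swap tri))
      where
      tri : Trisection S s t [ s ] inner [ t ]
      tri = trisect shape (here refl) (proj₂ inhabitant) (here refl)

    tree-zero : TreeModel 0 S s t
    tree-zero with cut-path {s ∷ inner} {[ t ]} shape (here refl) (here refl)
    ... | cut with Half.end-or-tail (Cut.left cut) (there (proj₂ inhabitant))
    ... | inj₂ w∈ = tree-base cut w∈
    ... | inj₁ refl = ⊥-elim (unique-disjoint [ s ] (subst Unique shape unique) (here refl)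
                                (∈-++⁺ˡ (proj₂ inhabitant)))

    tree-zero′ : TreeModel 0 S t s
    tree-zero′ with cut-swap (cut-path {[ s ]} {inner ∷ʳ t} shape (here refl) (∈-++⁺ˡ (proj₂ inhabitant)))
    ... | cut with Half.end-or-tail (Cut.left cut) (∈-++⁺ˡ (proj₂ inhabitant))
    ... | inj₂ w∈ = tree-base cut w∈
    ... | inj₁ refl = ⊥-elim (unique-disjoint (s ∷ inner) (subst Unique shape unique)
                                (there (proj₂ inhabitant)) (here refl))

  extend : ∀ {S S₁ s t α β a b i j k} → Cut S s t α β → Avoids S₁ α → Avoids S₁ β
    → (∀ {w} → S₁ w → S w) → a ∈ α → b ∈ β → Outcome i j k S₁ a b → Outcome i j k S s t
  extend cut α₁ β₁ S₁⊆S a∈ b∈ (inj₁ (M , N)) =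
    inj₁ ( nabla-extend cut α₁ β₁ S₁⊆S a∈ b∈ M
         , nabla-extend (cut-swap cut) β₁ α₁ S₁⊆S b∈ a∈ N )
  extend cut α₁ β₁ S₁⊆S a∈ b∈ (inj₂ (inj₁ M)) =
    inj₂ (inj₁ (tree-extend cut α₁ β₁ S₁⊆S a∈ b∈ M))
  extend cut α₁ β₁ S₁⊆S a∈ b∈ (inj₂ (inj₂ M)) =
    inj₂ (inj₂ (tree-extend (cut-swap cut) β₁ α₁ S₁⊆S b∈ a∈ M))

  -- The induction step at a vertex of the tree.

  record ChildModels (h : ℕ) (S D : VSet) (a b : Fin n) : Set₁ where
    field
      a∈D   : D a
      b∈D   : D b
      solve : ∀ i j k → i + j + k ≤ 2 + h → Outcome i j k S a b

  childModels-swap : ∀ {h S D a b} → ChildModels h S D a b → ChildModels h S D b a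
  childModels-swap {h} M = record
    { a∈D = b∈D ; b∈D = a∈D
    ; solve = λ i j k le → outcome-swap (solve i k j (subst (_≤ 2 + h) (+-exchangeʳ i j k) le)) }
    where open ChildModels M

  -- The children are asked for a ∇ one smaller and for trees of full size. A tree from either child
  -- is already large enough and is extended along the path; otherwise the two ∇-models are joined.
  split-step : ∀ {S S₁ S₂ D₁ D₂ s t p h i j k} → PathBetween S s t p
    → Avoids S₁ p → Avoids S₂ p → (∀ {w} → S₁ w → ¬ S₂ w)
    → (∀ {w} → S₁ w → S w) → (∀ {w} → S₂ w → S w)
    → Split p (ChildModels h S₁ D₁) (ChildModels h S₂ D₂)
    → i + suc j + suc k ≤ 2 + h → Outcome (suc i) (suc j) (suc k) S s t
  split-step {S} {S₁} {S₂} {s = s} {t} {p} {h} {i} {j} {k} path p₁ p₂ S₁∩S₂ S₁⊆S S₂⊆S split bound =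
    go (ChildModels.solve Eab i (suc j) (suc k) bound) (ChildModels.solve Fcd i (suc j) (suc k) bound)
    where
    open Split split

    p≡′ : p ≡ (α ++ β) ++ γ
    p≡′ = trans p≡ (≡-sym (++-assoc α β γ))

    α⊆p : ∀ {w} → w ∈ α → w ∈ p
    α⊆p w∈ = subst (_ ∈_) (≡-sym p≡) (∈-++⁺ˡ w∈)

    βγ⊆p : ∀ {w} → w ∈ β ++ γ → w ∈ p
    βγ⊆p w∈ = subst (_ ∈_) (≡-sym p≡) (∈-++⁺ʳ α w∈)

    αβ⊆p : ∀ {w} → w ∈ α ++ β → w ∈ p
    αβ⊆p w∈ = subst (_ ∈_) (≡-sym p≡′) (∈-++⁺ˡ w∈)

    β⊆p : ∀ {w} → w ∈ β → w ∈ p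
    β⊆p w∈ = βγ⊆p (∈-++⁺ˡ w∈)

    γ⊆p : ∀ {w} → w ∈ γ → w ∈ p
    γ⊆p w∈ = βγ⊆p (∈-++⁺ʳ β w∈)

    tri : Trisection S s t α β γ
    tri = trisect path p≡ a∈α b∈β d∈γ

    go : Outcome i (suc j) (suc k) S₁ a b → Outcome i (suc j) (suc k) S₂ c d
      → Outcome (suc i) (suc j) (suc k) S s t
    go (inj₂ o) _ = extend (cut-path path p≡ a∈α (∈-++⁺ˡ b∈β)) (p₁ ∘ α⊆p) (p₁ ∘ βγ⊆p)
      S₁⊆S a∈α (∈-++⁺ˡ b∈β) (inj₂ o)
    go (inj₁ _) (inj₂ o) = extend (cut-path path p≡′ (∈-++⁺ʳ α c∈β) d∈γ) (p₂ ∘ αβ⊆p) (p₂ ∘ γ⊆p)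
      S₂⊆S (∈-++⁺ʳ α c∈β) d∈γ (inj₂ o)
    -- The same two models, with the roles of the children exchanged, also give the reversed
    -- orientation.
    go (inj₁ (M , _)) (inj₁ (_ , N)) = inj₁
      ( nabla-join tri (p₁ ∘ α⊆p) (p₁ ∘ β⊆p) (p₁ ∘ γ⊆p) (p₂ ∘ α⊆p) (p₂ ∘ β⊆p) (p₂ ∘ γ⊆p)
          S₁∩S₂ S₁⊆S S₂⊆S a∈α b∈β c∈β d∈γ M N
      , nabla-join (trisection-swap tri)
          (p₂ ∘ γ⊆p) (p₂ ∘ β⊆p) (p₂ ∘ α⊆p) (p₁ ∘ γ⊆p) (p₁ ∘ β⊆p) (p₁ ∘ α⊆p)
          (λ x y → S₁∩S₂ y x) S₂⊆S S₁⊆S d∈γ c∈β b∈β a∈α N M )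

  -- Only the tree parameter `j` drops for the children. A child with a ∇ or a tree of the other
  -- kind is extended; if neither has one, the two smaller trees are joined.
  overlap-step : ∀ {S s t α β h i j k} → Cut S s t α β → (Sᶜ D : Bool → VSet)
    → (∀ c → Avoids (Sᶜ c) α) → (∀ c → Avoids (Sᶜ c) β)
    → (∀ {w} → Sᶜ false w → ¬ Sᶜ true w) → (∀ c {w} → Sᶜ c w → S w)
    → (∀ c → ¬ D c s) → (a b : Bool → Fin n) → (∀ c → a c ∈ α) → (∀ c → b c ∈ β)
    → (∀ c → ChildModels h (Sᶜ c) (D c) (a c) (b c))
    → suc i + j + suc k ≤ 2 + h → Outcome (suc i) (suc j) (suc k) S s t
  overlap-step {S} {s} {t} {i = i} {j} {k} cut Sᶜ D αᶜ βᶜ disj Sᶜ⊆S clean a b a∈ b∈ M bound =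
    go (solution false) (solution true)
    where
    solution : ∀ c → Outcome (suc i) j (suc k) (Sᶜ c) (a c) (b c)
    solution c = ChildModels.solve (M c) (suc i) j (suc k) bound

    extend-child : ∀ c → Outcome (suc i) (suc j) (suc k) (Sᶜ c) (a c) (b c)
      → Outcome (suc i) (suc j) (suc k) S s t
    extend-child c = extend cut (αᶜ c) (βᶜ c) (Sᶜ⊆S c) (a∈ c) (b∈ c)

    -- Cleanness enters here: `a c` lies on a child ear and `s` does not, so they differ.
    a∈tail : ∀ c → a c ∈ Half.tail (Cut.left cut)
    a∈tail c with Half.end-or-tail (Cut.left cut) (a∈ c)
    ... | inj₁ eq = ⊥-elim (clean c (subst (D c) eq (ChildModels.a∈D (M c))))
    ... | inj₂ w∈ = w∈

    go : Outcome (suc i) j (suc k) (Sᶜ false) (a false) (b false)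
      → Outcome (suc i) j (suc k) (Sᶜ true) (a true) (b true)
      → Outcome (suc i) (suc j) (suc k) S s t
    go (inj₁ N) _ = extend-child false (inj₁ N)
    go (inj₂ (inj₂ N)) _ = extend-child false (inj₂ (inj₂ N))
    go (inj₂ (inj₁ _)) (inj₁ N) = extend-child true (inj₁ N)
    go (inj₂ (inj₁ _)) (inj₂ (inj₂ N)) = extend-child true (inj₂ (inj₂ N))
    go (inj₂ (inj₁ M₀)) (inj₂ (inj₁ M₁)) = inj₂ (inj₁
      (tree-join cut Sᶜ αᶜ βᶜ disj Sᶜ⊆S a b a∈tail b∈ λ { false → M₀ ; true → M₁ }))

  node-step : ∀ {S s t p h i j k} → PathBetween S s t p → (Sᶜ D : Bool → VSet)
    → (∀ c → Avoids (Sᶜ c) p)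
    → (∀ {w} → Sᶜ false w → ¬ Sᶜ true w) → (∀ c {w} → Sᶜ c w → S w)
    → (∀ c → ¬ D c s) ⊎ (∀ c → ¬ D c t)
    → (∀ c → Chord p (ChildModels h (Sᶜ c) (D c)))
    → i + j + k ≤ h → Outcome (suc i) (suc j) (suc k) S s t
  node-step {S} {s} {t} {p} {h} {i} {j} {k} path Sᶜ D avoid disj Sᶜ⊆S clean chords bound
    with arrange (chords false) (chords true)
  ... | inj₁ split = split-step path (avoid false) (avoid true) disj (Sᶜ⊆S false) (Sᶜ⊆S true) split
    (subst (_≤ 2 + h) (≡-sym (+-suc₂₃ i j k))
      (s≤s (s≤s bound)))
  ... | inj₂ (inj₁ split) = split-step path (avoid true) (avoid false) (λ x y → disj y x)
    (Sᶜ⊆S true) (Sᶜ⊆S false) split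
    (subst (_≤ 2 + h) (≡-sym (+-suc₂₃ i j k))
      (s≤s (s≤s bound)))
  ... | inj₂ (inj₂ crossing) = go clean
    where
    open Overlap crossing
    cut : Cut S s t α β
    cut = cut-path path p≡ a∈α b∈β

    αᶜ : ∀ x → Avoids (Sᶜ x) α
    αᶜ x w∈ = avoid x (subst (_ ∈_) (≡-sym p≡) (∈-++⁺ˡ w∈))

    βᶜ : ∀ x → Avoids (Sᶜ x) β
    βᶜ x w∈ = avoid x (subst (_ ∈_) (≡-sym p≡) (∈-++⁺ʳ α w∈))

    left-end right-end : Bool → Fin n
    left-end false = a
    left-end true = c
    right-end false = b
    right-end true = d

    left∈ : ∀ x → left-end x ∈ α
    left∈ false = a∈α
    left∈ true = c∈α

    right∈ : ∀ x → right-end x ∈ β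
    right∈ false = b∈β
    right∈ true = d∈β

    models : ∀ x → ChildModels h (Sᶜ x) (D x) (left-end x) (right-end x)
    models false = Eab
    models true = Fcd

    go : (∀ c → ¬ D c s) ⊎ (∀ c → ¬ D c t) → Outcome (suc i) (suc j) (suc k) S s t
    go (inj₁ clean-s) = overlap-step cut Sᶜ D αᶜ βᶜ disj Sᶜ⊆S clean-s
      left-end right-end left∈ right∈ models
      (subst (_≤ 2 + h) (≡-sym (cong suc (+-suc (i + j) k))) (s≤s (s≤s bound)))
    -- When `t` is the clean end, the path is read backwards, so it is `k` that drops.
    go (inj₂ clean-t) = outcome-swap (overlap-step (cut-swap cut) Sᶜ D βᶜ αᶜ disj Sᶜ⊆S clean-t
      right-end left-end right∈ left∈ (childModels-swap ∘ models)
      (subst (_≤ 2 + h) (≡-sym (trans (cong suc (+-suc (i + k) j)) (cong (2 +_) (+-exchangeʳ i k j))))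
        (s≤s (s≤s bound))))

  -- Ear trees and the induction on height.

  module _ {m} {P : List Bool → List (Fin n)} (ear-tree : BinaryEarTreeΓ m G P) (clean : Clean m P) where

    Inside : List Bool → VSet
    Inside y w = ∃[ z ] (y ⊑ z × length z ≤ m × Internal w (P z))

    internal∈ : ∀ {w : Fin n} {p} → Internal w p → w ∈ p
    internal∈ (xs , _ , refl , _) = ∈-++⁺ʳ xs (here refl)

    -- A vertex inside the subtree is internal to the ear of some `x` in it, and the subtree at `x`
    -- is contained in the one at `c ∷ y`, so condition (2) at `x` excludes `z`. The split on the
    -- prefix exhibits `x` as a non-root address.
    inside-outside : ∀ {c y w z} → Inside (c ∷ y) w → length z ≤ m → ¬ (c ∷ y) ⊑ z → ¬ w ∈ P z
    inside-outside {c} {y} (_ , ([] , refl) , x≤m , int) z≤m incomparable =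
      proj₂ (proj₂ ear-tree) c y x≤m _ z≤m incomparable _ int
    inside-outside {c} {y} (_ , (b ∷ d , refl) , x≤m , int) z≤m incomparable =
      proj₂ (proj₂ ear-tree) b (d ++ c ∷ y) x≤m _ z≤m
        (λ { (e , eq) → incomparable (e ++ b ∷ d , trans eq (≡-sym (++-assoc e (b ∷ d) (c ∷ y)))) })
        _ int

    inside-avoids : ∀ {y} c → length y ≤ m → Avoids (Inside (c ∷ y)) (P y)
    inside-avoids {y} c y≤m w∈ inside = inside-outside inside y≤m
      (λ { (d , eq) → 1+n≰n (subst (λ l → suc (length y) ≤ l) (≡-sym (trans (cong length eq) (length-++ d)))
                               (m≤n+m (suc (length y)) (length d))) }) w∈

    -- An address below `true ∷ y` cannot lie below `false ∷ y`: cancelling `y` leaves two lists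
    -- with different last entries.
    inside-disjoint : ∀ {y w} → Inside (false ∷ y) w → ¬ Inside (true ∷ y) w
    inside-disjoint {y} inside (_ , (d , refl) , z≤m , int) = inside-outside inside z≤m
      (λ { (e , eq) → true≢false (∷ʳ-injectiveʳ d e (++-cancelʳ y (d ∷ʳ true) (e ∷ʳ false)
             (trans (∷ʳ-++ d true y) (trans eq (≡-sym (∷ʳ-++ e false y)))))) })
      (internal∈ int)
      where
      true≢false : true ≢ false
      true≢false ()

    inside-mono : ∀ {y} c {w} → Inside (c ∷ y) w → Inside y w
    inside-mono {y} c (_ , (d , refl) , rest) = _ , (d ∷ʳ c , ≡-sym (∷ʳ-++ d c y)) , rest

    path-at : ∀ y → length y ≤ m → ∃[ s ] ∃[ t ] PathBetween (Inside y) s t (P y)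
    path-at y y≤m with proj₁ ear-tree y y≤m
    ... | (unique , linked , _) , long with ends-and-inner (P y) long
    ... | s , x , q , t , shape = s , t , record
      { inner = x ∷ q ; shape = shape ; inhabitant = x , here refl
      ; unique = unique ; linked = linked
      ; covered = λ w∈ → position (subst (_ ∈_) shape w∈) }
      where
      position : ∀ {w} → w ∈ s ∷ (x ∷ q) ∷ʳ t → w ≡ s ⊎ w ≡ t ⊎ Inside y w
      position (here refl) = inj₁ refl
      position {w} (there w∈) with ∈-++⁻ (x ∷ q) w∈
      ... | inj₂ (here refl) = inj₂ (inj₁ refl)
      ... | inj₁ w∈inner with ∈-∃++ w∈inner
      ... | us , vs , inner≡ = inj₂ (inj₂ (y , ([] , refl) , y≤m , s ∷ us , vs ∷ʳ t
        , trans shape (cong (s ∷_) (trans (cong (_∷ʳ t) inner≡) (++-assoc us (w ∷ vs) [ t ])))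
        , (λ ()) , ∷ʳ≢[] vs))

    end-of : ∀ {S s t p v} → PathBetween S s t p → End v p → v ≡ s ⊎ v ≡ t
    end-of path (inj₁ (_ , eq)) =
      inj₁ (proj₁ (∷-injective (trans (≡-sym eq) (PathBetween.shape path))))
    end-of {s = s} path (inj₂ (q , eq)) =
      inj₂ (∷ʳ-injectiveʳ q (s ∷ inner) (trans (≡-sym eq) shape))
      where open PathBetween path

    -- Here `h` is the height of the subtree at `y`. A zero parameter is settled by the path alone,
    -- and each level down lowers one parameter and `h` by one.
    outcome : ∀ h y → length y + h ≡ m → ∀ {s t} → PathBetween (Inside y) s t (P y)
      → ∀ i j k → i + j + k ≤ 2 + h → Outcome i j k (Inside y) s t
    outcome h y len path zero j k _ = nabla-zero path
    outcome h y len path (suc i) zero k _ = inj₂ (inj₁ (tree-zero path))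
    outcome h y len path (suc i) (suc j) zero _ = inj₂ (inj₂ (tree-zero′ path))
    -- At a leaf the sum is at most 2, so the three parameters cannot all be positive.
    outcome zero y _ _ (suc i) (suc j) (suc k) (s≤s bound)
      with subst (_≤ 1) (+-suc₂₃ i j k) bound
    ... | s≤s ()
    outcome (suc h) y len {s} {t} path (suc i) (suc j) (suc k) (s≤s bound) =
      node-step path (λ c → Inside (c ∷ y)) (λ c → _∈ P (c ∷ y))
        (λ c → inside-avoids c (≤-trans (m≤m+n (length y) (suc h)) (≤-reflexive len)))
        inside-disjoint inside-mono clean-end child-chord
        (s≤s⁻¹ (s≤s⁻¹ (subst (_≤ 2 + h) (+-suc₂₃ i j k) bound)))
      where
      len′ : suc (length y) + h ≡ m
      len′ = trans (≡-sym (+-suc (length y) h)) len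

      y<m : suc (length y) ≤ m
      y<m = ≤-trans (m≤m+n (suc (length y)) h) (≤-reflexive len′)

      clean-end : (∀ c → ¬ s ∈ P (c ∷ y)) ⊎ (∀ c → ¬ t ∈ P (c ∷ y))
      clean-end with clean y y<m
      ... | v , end , avoided with end-of path end
      ... | inj₁ refl = inj₁ avoided
      ... | inj₂ refl = inj₂ avoided

      child-chord : ∀ c → Chord (P y) (ChildModels h (Inside (c ∷ y)) (_∈ P (c ∷ y)))
      child-chord c with path-at (c ∷ y) y<m
      ... | u , v , child = chord models (childModels-swap models)
        (ends∈ u (inj₁ (_ , shape))) (ends∈ v (inj₂ (u ∷ inner , shape)))
        λ { refl → unique-disjoint [ u ] (subst Unique shape unique) (here refl)
                     (∈-++⁺ʳ inner (here refl)) }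
        where
        open PathBetween child
        ends∈ : ∀ w → End w (P (c ∷ y)) → w ∈ P y
        ends∈ = proj₁ (proj₁ (proj₂ ear-tree) c y y<m)

        models : ChildModels h (Inside (c ∷ y)) (_∈ P (c ∷ y)) u v
        models = record
          { a∈D = subst (u ∈_) (≡-sym shape) (here refl)
          ; b∈D = subst (v ∈_) (≡-sym shape) (∈-++⁺ʳ (u ∷ inner) (here refl))
          ; solve = outcome h (c ∷ y) len′ child }

theorem3p1 : (k : ℕ) {n : ℕ} (G : FinGraph n) (P : List Bool → List (Fin n))
    → BinaryEarTreeΓ (3 * suc k ∸ 2) G P
    → Clean (3 * suc k ∸ 2) P
    → (GammaPlus (suc k) ≼ G) ⊎ (Nabla k ≼ G)
-- With ℓ = `suc k`, all parameters are ℓ, and 3ℓ is at most 2 plus the height. The first kind then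
-- gives ∇_{ℓ+1} without its root edge, which contains ∇_ℓ, that is, `Nabla k`.
theorem3p1 k G P ear-tree clean = conclude
  (outcome ear-tree clean height [] refl (proj₂ (proj₂ (path-at ear-tree clean [] z≤n)))
    (suc k) (suc k) (suc k) bound)
  where
  open Models G
  height : ℕ
  height = 3 * suc k ∸ 2

  bound : suc k + suc k + suc k ≤ 2 + height
  bound = subst (_≤ 2 + height)
    (trans (cong (λ l → suc k + (suc k + l)) (+-identityʳ (suc k))) (≡-sym (+-assoc (suc k) (suc k) (suc k))))
    (m≤n+m∸n (3 * suc k) 2)

  conclude : ∀ {S s t} → Outcome (suc k) (suc k) (suc k) S s t
    → (GammaPlus (suc k) ≼ G) ⊎ (Nabla k ≼ G)
  conclude (inj₁ (M , _)) = inj₂ (nablaModel⇒minor M)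
  conclude (inj₂ (inj₁ M)) = inj₁ (treeModel⇒minor M)
  conclude (inj₂ (inj₂ M)) = inj₁ (treeModel⇒minor M)
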